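{- Let $q$ be a prime power, $N\ge 1$, and let $t,k,v$ be integers with $0\le t\le k-1$ and $t\le v-1$. If there exist an $\mathrm{LS}_q[N](t,k-1,v-1)$ and an $\mathrm{LS}_q[N](t,k,v-1)$, then there exists an $\mathrm{LS}_q[N](t,k,v)$.
   Context: For a $v$-dimensional vector space $V$ over the finite field $\mathrm{GF}(q)$, a pair $(V,\mathcal{B})$ with $\mathcal{B}$ a set of $k$-dimensional subspaces of $V$ is a $t$-$(v,k,\lambda)_q$ (subspace) design if every $t$-dimensional subspace of $V$ is contained in exactly $\lambda$ elements of $\mathcal{B}$. A large set $\mathrm{LS}_q[N](t,k,v)$ is a family $(V,\mathcal{B}_1),\ldots,(V,\mathcal{B}_N)$ of $t$-$(v,k,\lambda)_q$ designs on the same $v$-dimensional $\mathrm{GF}(q)$-vector space $V$, all with the same $\lambda$, such that the block sets $\mathcal{B}_1,\ldots,\mathcal{B}_N$ are pairwise disjoint and their union is the set of all $k$-dimensional subspaces of $V$. (In degenerate cases the $\mathcal{B}_i$ may be empty.) -}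

module Defs where

open import Algebra.Apartness.Bundles using (HeytingField; HeytingCommutativeRing)
open import Algebra.Bundles using (CommutativeRing)
import Algebra.Definitions.RawMonoid as RawMonoidDefinitions
open import Algebra.Module.Bundles using (Module)
open import Data.Fin.Base using (Fin)
open import Data.Nat.Base using (ℕ; _≤_; _^_)
open import Data.Nat.Primality using (Prime)
open import Data.Product.Base using (Σ-syntax; ∃-syntax; _×_; _,_; proj₁; swap)
open import Data.Vec.Functional using (Vector)
open import Function.Base using (id)
open import Function.Bundles using (Bijection)
open import Level using (0ℓ; suc; _⊔_)
open import Relation.Binary.Bundles using (Setoid)
open import Relation.Binary.Core using (Rel)
open import Relation.Binary.Definitions using (_Respects_)
open import Relation.Binary.PropositionalEquality.Core using (_≡_; _≢_)
open import Relation.Binary.PropositionalEquality.Properties using (setoid)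
open import Relation.Unary using (Pred; U; _∈_; _⊆_; _≐_; _⊥_; ⋃)

IsPrimePower : ℕ → Set
IsPrimePower q = ∃[ p ] ∃[ n ] Prime p × 1 ≤ n × q ≡ p ^ n

HasCardinality : ∀ {c ℓ} → Setoid c ℓ → ℕ → Set (c ⊔ ℓ)
HasCardinality S n = Bijection (setoid (Fin n)) S

-- On a finite carrier the apartness of a Heyting field is forced to be the
-- negation of its equality, so a Heyting field whose carrier has q elements
-- is exactly a field with q elements, that is, GF(q).
record FiniteField (q : ℕ) : Set (suc 0ℓ) where
  field
    heytingField : HeytingField 0ℓ 0ℓ 0ℓ

  commutativeRing : CommutativeRing 0ℓ 0ℓ
  commutativeRing = HeytingCommutativeRing.commutativeRing
    (HeytingField.heytingCommutativeRing heytingField)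

  open CommutativeRing commutativeRing public

  field
    cardinality : HasCardinality (CommutativeRing.setoid commutativeRing) q

VectorSpace : ∀ {q} → FiniteField q → Set (suc 0ℓ)
VectorSpace F = Module (FiniteField.commutativeRing F) 0ℓ 0ℓ

module _ {q : ℕ} (F : FiniteField q) (V : VectorSpace F) where

  open FiniteField F using (Carrier; _≈_; 0#)
  open Module V
  open RawMonoidDefinitions +ᴹ-rawMonoid using (sum)

  linearCombination : ∀ {n} → Vector Carrier n → Vector Carrierᴹ n → Carrierᴹ
  linearCombination c b = sum (λ i → c i *ₗ b i)

  LinearlyIndependent : ∀ {n} → Vector Carrierᴹ n → Set
  LinearlyIndependent b =
    ∀ c → linearCombination c b ≈ᴹ 0ᴹ → ∀ i → c i ≈ 0#

  record IsBasis {n} (W : Pred Carrierᴹ 0ℓ) (b : Vector Carrierᴹ n) : Set where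
    field
      inside      : ∀ i → b i ∈ W
      independent : LinearlyIndependent b
      spanning    : ∀ {x} → x ∈ W → ∃[ c ] x ≈ᴹ linearCombination c b

  HasDimension : ℕ → Pred Carrierᴹ 0ℓ → Set
  HasDimension n W = Σ[ b ∈ Vector Carrierᴹ n ] IsBasis W b

  record Subspace : Set (suc 0ℓ) where
    field
      Member    : Pred Carrierᴹ 0ℓ
      resp      : Member Respects _≈ᴹ_
      0-closed  : 0ᴹ ∈ Member
      +-closed  : ∀ {x y} → x ∈ Member → y ∈ Member → x +ᴹ y ∈ Member
      *ₗ-closed : ∀ a {x} → x ∈ Member → a *ₗ x ∈ Member

  open Subspace using (Member)

  _⊆ˢ_ : Rel Subspace 0ℓ
  X ⊆ˢ Y = Member X ⊆ Member Y

  -- Subspaces are compared as sets of vectors.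
  _≈ˢ_ : Rel Subspace 0ℓ
  X ≈ˢ Y = Member X ≐ Member Y

  OfDimension : ℕ → Pred Subspace 0ℓ
  OfDimension n X = HasDimension n (Member X)

  -- Containment proofs and block-membership proofs play no role in the
  -- equality, so that the cardinality counts subspaces.
  blocksContaining : Pred Subspace 0ℓ → Subspace → Setoid (suc 0ℓ) 0ℓ
  blocksContaining 𝓑 T = record
    { Carrier       = Σ[ K ∈ Subspace ] (K ∈ 𝓑 × T ⊆ˢ K)
    ; _≈_           = λ K L → proj₁ K ≈ˢ proj₁ L
    ; isEquivalence = record
      { refl  = id , id
      ; sym   = swap
      ; trans = λ (f , f′) (g , g′) → (λ x → g (f x)) , (λ x → f′ (g′ x))
      }
    }

  record IsSubspaceDesign (t v k λ′ : ℕ) (𝓑 : Pred Subspace 0ℓ) : Set (suc 0ℓ) where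
    field
      ambient-dimension : HasDimension v U
      respects          : 𝓑 Respects _≈ˢ_
      block-dimension   : 𝓑 ⊆ OfDimension k
      balanced          : ∀ T → T ∈ OfDimension t →
                          HasCardinality (blocksContaining 𝓑 T) λ′

record LargeSet {q : ℕ} (F : FiniteField q) (N t k v : ℕ) : Set (suc 0ℓ) where
  field
    V        : VectorSpace F
    λ′       : ℕ
    𝓑        : Fin N → Pred (Subspace F V) 0ℓ
    design   : ∀ i → IsSubspaceDesign F V t v k λ′ (𝓑 i)
    disjoint : ∀ {i j} → i ≢ j → 𝓑 i ⊥ 𝓑 j
    union    : ⋃ (Fin N) 𝓑 ≐ OfDimension F V k

{-# OPTIONS --safe #-}
-- Let H be a hyperplane of the v-space V, and identify it with the ambient
-- spaces of both given large sets.  The i-th block set of the new large set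
-- consists of the K ⊆ H that are i-th blocks of the LS(t,k,v-1) and of the
-- K ⊈ H for which K ∩ H is an i-th block of the LS(t,k-1,v-1).
--
-- For a t-space T the number of i-th blocks containing T does not depend on i.
-- If T ⊆ H, the blocks through T inside H number λ₂, and those crossing H are
-- counted by the pairs (x , L) with x ∉ H and L ⊇ T an i-th block of the
-- LS(t,k-1,v-1), through K = L + ⟨x⟩.  If T ⊈ H, then K = (K ∩ H) + T, and one
-- counts the blocks through the (t-1)-space T ∩ H, because a t-design is a
-- (t-1)-design.  That these two numbers agree needs no q-Pascal identity: N
-- times either of them is the number of all k-spaces through T, which depends
-- only on dim T because the k-spaces themselves form a design of every
-- strength at most k.
module Submission where

open import Defs
open import Algebra.Apartness.Bundles using (HeytingField)
open import Algebra.Module.Bundles using (Module)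
import Algebra.Module.Construct.DirectProduct as DirectProduct
import Algebra.Module.Construct.TensorUnit as TensorUnit
import Algebra.Module.Properties.LeftModule as LeftModuleProperties
import Algebra.Properties.AbelianGroup as AbelianGroupProperties
import Algebra.Properties.CommutativeSemigroup as CommutativeSemigroupProperties
import Algebra.Properties.Ring as RingProperties
open import Data.Empty using (⊥-elim)
open import Data.Fin.Base
  using (Fin; combine; finToFun; funToFin; join; remQuot; splitAt; suc; zero)
open import Data.Fin.Properties
  using (*↔×; +↔⊎; _≟_; any?; finToFun-funToFin; funToFin-finToFin; injective⇒≤; remQuot-combine;
    splitAt-join)
open import Data.Maybe.Base using (Maybe; just; nothing)
open import Data.Maybe.Properties using (just-injective)
open import Data.Nat.Base
  using (>-nonZero; NonZero; _*_; _+_; _/_; _<_; _^_; _∸_; _≤_; nonTrivial⇒n>1; suc; s≤s; s≤s⁻¹;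
    zero; ℕ)
open import Data.Nat.DivMod using (m*n/n≡m)
open import Data.Nat.Primality using (prime⇒nonTrivial)
open import Data.Nat.Properties
  using (*-comm; +-suc; <-irrefl; <⇒≱; ^-monoʳ-<; m+n∸m≡n; m<n⇒0<n∸m; m∸n+n≡m; m≤m+n; m≤n+m;
    m≤n⇒m≤1+n; n<1+n; ≤-antisym; ≤-reflexive; ≤-trans; ≮⇒≥)
open import Data.Product.Base using (_,_; _×_; map₂; proj₁; proj₂; Σ; Σ-syntax; ∃; ∃-syntax)
open import Data.Product.Relation.Binary.Pointwise.NonDependent using (×-setoid)
open import Data.Sum.Base using ([_,_]; _⊎_; inj₁; inj₂)
open import Data.Unit.Base using (tt)
open import Data.Vec.Functional using (Vector; []; _∷_)
open import Function.Base using (_∘_; id)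
open import Function.Bundles using (Bijection; Injection)
open import Function.Properties.Inverse using (↔⇒↣)
open import Level using (0ℓ; Level)
open import Relation.Binary.Bundles using (Setoid)
import Relation.Binary.Construct.On as On
open import Relation.Binary.Definitions using (Decidable; _Respects_)
open import Relation.Binary.PropositionalEquality.Core as ≡
  using (_≡_; _≢_; cong; refl; subst; sym; trans)
open import Relation.Binary.PropositionalEquality.Properties using (setoid)
import Relation.Binary.Reasoning.Setoid as SetoidReasoning
open import Relation.Nullary.Decidable
  using (Dec; _×-dec_; _→-dec_; decidable-stable; map′; no; yes; ¬?)
open import Relation.Nullary.Negation using (contradiction; ¬_)
open import Relation.Unary as Unary using (Pred; U; _∈_; _∉_; _⊆_; _⊥_; ∁)

private
  variable
    a ℓ a′ ℓ′ a″ ℓ″ p : Level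
    m n o : ℕ

-- Counting in finite setoids.

restrict : (S : Setoid a ℓ) → Pred (Setoid.Carrier S) p → Setoid _ _
restrict S P = On.setoid {B = Σ (Setoid.Carrier S) P} S proj₁

fibre : (A : Setoid a ℓ) (B : Setoid a′ ℓ′) →
        (Setoid.Carrier A → Setoid.Carrier B) → Setoid.Carrier B → Setoid _ _
fibre A B f b = restrict A (λ x → Setoid._≈_ B (f x) b)

module _ {S : Setoid a ℓ} where

  open Setoid S using (Carrier; _≈_) renaming (refl to ≈-refl; sym to ≈-sym; trans to ≈-trans)

  enumeration⇒card : (e : Fin n → Carrier) → (∀ {i j} → e i ≈ e j → i ≡ j) →
                     (∀ y → ∃[ i ] e i ≈ y) → HasCardinality S n
  enumeration⇒card e inj surj = record
    { to        = e
    ; cong      = λ { refl → ≈-refl }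
    ; bijective = inj , λ y → proj₁ (surj y) , λ { refl → proj₂ (surj y) }
    }

  module Card (card : HasCardinality S n) where

    elem : Fin n → Carrier
    elem = Bijection.to card

    elem-injective : ∀ {i j} → elem i ≈ elem j → i ≡ j
    elem-injective = Bijection.injective card

    index : Carrier → Fin n
    index y = proj₁ (Bijection.surjective card y)

    elem-index : ∀ y → elem (index y) ≈ y
    elem-index y = proj₂ (Bijection.surjective card y) refl

    index-cong : ∀ {x y} → x ≈ y → index x ≡ index y
    index-cong {x} {y} x≈y = elem-injective
      (≈-trans (elem-index x) (≈-trans x≈y (≈-sym (elem-index y))))

    index-injective : ∀ {x y} → index x ≡ index y → x ≈ y
    index-injective {x} {y} eq =
      ≈-trans (≈-sym (elem-index x)) (subst (λ i → elem i ≈ y) (sym eq) (elem-index y))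

    ≈-dec : Decidable _≈_
    ≈-dec x y = map′ index-injective index-cong (index x ≟ index y)

    ∃-dec : {P : Pred Carrier p} → P Respects _≈_ → Unary.Decidable P → Dec (∃ P)
    ∃-dec resp P? = map′ (λ (i , Pi) → elem i , Pi)
      (λ (x , Px) → index x , resp (≈-sym (elem-index x)) Px) (any? (P? ∘ elem))

    ∀-dec : {P : Pred Carrier p} → P Respects _≈_ → Unary.Decidable P → Dec (∀ x → P x)
    ∀-dec resp P? with ∃-dec (λ x≈y ¬Px Py → ¬Px (resp (≈-sym x≈y) Py)) (λ x → ¬? (P? x))
    ... | yes (x , ¬Px) = no (λ all → ¬Px (all x))
    ... | no ¬∃¬        = yes λ x → decidable-stable (P? x) (λ ¬Px → ¬∃¬ (x , ¬Px))

  open Card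

  card-unique : HasCardinality S m → HasCardinality S n → m ≡ n
  card-unique c d = ≤-antisym (below c d) (below d c)
    where
    below : (c : HasCardinality S m) (d : HasCardinality S n) → _
    below c d = injective⇒≤ {f = index d ∘ elem c} (elem-injective c ∘ index-injective d)

  private
    -- By recursion on the list: the tail is already listed without repetition, and the head is put
    -- in front only if it does not occur there. An entry `nothing` is skipped, so a list can be
    -- filtered before the number of surviving entries is known.
    nonRepeating : Decidable _≈_ → ∀ o (g : Fin o → Maybe Carrier) →
      ∃[ n ] Σ[ e ∈ (Fin n → Carrier) ] (∀ {i j} → e i ≈ e j → i ≡ j) ×
        (∀ i x → g i ≡ just x → ∃[ j ] e j ≈ x)
    nonRepeating _≈?_ zero    g = 0 , (λ ()) , (λ { {()} }) , λ ()
    nonRepeating _≈?_ (suc o) g with nonRepeating _≈?_ o (g ∘ suc) | g zero in eq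
    ... | n , e , inj , hits | nothing = n , e , inj , λ
      { zero    x g0≡x → contradiction (trans (sym eq) g0≡x) λ ()
      ; (suc i) x gi≡x → hits i x gi≡x }
    ... | n , e , inj , hits | just y with any? (λ j → e j ≈? y)
    ... | yes (j , ej≈y) = n , e , inj , λ
      { zero    x g0≡x → j , subst (e j ≈_) (just-injective (trans (sym eq) g0≡x)) ej≈y
      ; (suc i) x gi≡x → hits i x gi≡x }
    ... | no new = suc n , e⁺ , (λ {i} {j} → inj⁺ {i} {j}) , λ
      { zero    x g0≡x → zero , subst (y ≈_) (just-injective (trans (sym eq) g0≡x)) ≈-refl
      ; (suc i) x gi≡x → let (j , ej≈x) = hits i x gi≡x in suc j , ej≈x }
      where
      e⁺ : Fin (suc n) → Carrier
      e⁺ zero    = y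
      e⁺ (suc j) = e j

      inj⁺ : ∀ {i j} → e⁺ i ≈ e⁺ j → i ≡ j
      inj⁺ {zero}  {zero}  _ = refl
      inj⁺ {zero}  {suc j} h = ⊥-elim (new (j , ≈-sym h))
      inj⁺ {suc i} {zero}  h = ⊥-elim (new (i , h))
      inj⁺ {suc i} {suc j} h = cong suc (inj h)

  -- Finiteness without a prescribed size. The size is afterwards determined by a second count and
  -- `card-unique`.
  listed⇒card : Decidable _≈_ → (g : Fin o → Maybe Carrier) →
                (∀ y → ∃[ i ] ∃[ x ] g i ≡ just x × x ≈ y) → ∃[ n ] HasCardinality S n
  listed⇒card {o = o} _≈?_ g surj with nonRepeating _≈?_ o g
  ... | n , e , inj , hits = n , enumeration⇒card e inj λ y →
    let (i , x , gi≡x , x≈y) = surj y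
        (j , ej≈x) = hits i x gi≡x
    in j , ≈-trans ej≈x x≈y

card-restrict : {S : Setoid a ℓ} {P : Pred (Setoid.Carrier S) p} → HasCardinality S n →
                P Respects Setoid._≈_ S → Unary.Decidable P →
                ∃[ m ] HasCardinality (restrict S P) m
card-restrict {n = n} {S = S} {P = P} c resp P? =
  listed⇒card (λ x y → ≈-dec (proj₁ x) (proj₁ y)) select λ (y , Py) → covers y Py
  where
  open Setoid S using (Carrier; _≈_) renaming (sym to ≈-sym)
  open Card c

  select : Fin n → Maybe (Σ Carrier P)
  select i with P? (elem i)
  ... | yes Pi = just (elem i , Pi)
  ... | no _   = nothing

  covers : ∀ y → P y → ∃[ i ] ∃[ x ] select i ≡ just x × proj₁ x ≈ y
  -- The list holds `elem (index y)` in place of `y`; it satisfies `P` as well, since `P` respects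
  -- the equality.
  covers y Py with P? (elem (index y)) in eq
  ... | no ¬Py = contradiction (resp (≈-sym (elem-index y)) Py) ¬Py
  ... | yes Py′ = index y , (elem (index y) , Py′) , selected , elem-index y
    where
    selected : select (index y) ≡ just (elem (index y) , Py′)
    selected rewrite eq = refl

module _ {A : Setoid a ℓ} {B : Setoid a′ ℓ′} where

  private
    module A = Setoid A
    module B = Setoid B

  card-transfer : (f : A.Carrier → B.Carrier) → (∀ {x y} → x A.≈ y → f x B.≈ f y) →
                  (∀ {x y} → f x B.≈ f y → x A.≈ y) → (∀ y → ∃[ x ] f x B.≈ y) →
                  HasCardinality A n → HasCardinality B n
  card-transfer f f-cong f-inj f-surj c = enumeration⇒card (f ∘ elem) (elem-injective ∘ f-inj)
    λ y → let (x , fx≈y) = f-surj y in index x , B.trans (f-cong (elem-index x)) fx≈y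
    where open Card c

  -- An element of `A` is located by the index of its image and by its index within the fibre over
  -- that image. Together with `card-quotient` this carries the double counts below.
  card-fibred : (f : A.Carrier → B.Carrier) → (∀ {x y} → x A.≈ y → f x B.≈ f y) →
                HasCardinality B n → (∀ b → HasCardinality (fibre A B f b) m) →
                HasCardinality A (n * m)
  card-fibred {n = n} {m = m} f f-cong c fibres = enumeration⇒card (e ∘ remQuot m) inj surj
    where
    module C = Card c
    module Fib b = Card (fibres b)

    e : Fin n × Fin m → A.Carrier
    e (i , j) = proj₁ (Fib.elem (C.elem i) j)

    f∘e : ∀ i j → f (e (i , j)) B.≈ C.elem i
    f∘e i j = proj₂ (Fib.elem (C.elem i) j)

    e-injective : ∀ {x y} → e x A.≈ e y → x ≡ y
    e-injective {i , j} {i′ , j′} eq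
      with refl ← C.elem-injective (B.trans (B.sym (f∘e i j)) (B.trans (f-cong eq) (f∘e i′ j′)))
      = cong (i ,_) (Fib.elem-injective (C.elem i) eq)

    inj : ∀ {x y} → e (remQuot m x) A.≈ e (remQuot m y) → x ≡ y
    inj = Injection.injective (↔⇒↣ (*↔× {n} {m})) ∘ e-injective

    surj : ∀ x → ∃[ i ] e (remQuot m i) A.≈ x
    surj x = combine i j ,
      subst (λ ij → e ij A.≈ x) (sym (remQuot-combine i j)) (Fib.elem-index (C.elem i) (x , fx≈i))
      where
      i = C.index (f x)
      fx≈i = B.sym (C.elem-index (f x))
      j = Fib.index (C.elem i) (x , fx≈i)

  -- The fibres are nonempty because `m` is nonzero, so the images of the elements of `A` list `B`.
  -- If `o` is the size found in this way, `card-fibred` gives `o * m ≡ n`, and the division is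
  -- exact.
  card-quotient : .{{_ : NonZero m}} (f : A.Carrier → B.Carrier) →
                  (∀ {x y} → x A.≈ y → f x B.≈ f y) → Decidable B._≈_ →
                  HasCardinality A n → (∀ b → HasCardinality (fibre A B f b) m) →
                  HasCardinality B (n / m)
  card-quotient {m = m@(suc _)} {n = n} f f-cong _≈?_ c fibres
    with listed⇒card _≈?_ (just ∘ f ∘ Card.elem c) covers
    where
    covers : ∀ y → ∃[ i ] ∃[ x ] just (f (Card.elem c i)) ≡ just x × x B.≈ y
    covers y = let (x , fx≈y) = Card.elem (fibres y) zero in
      Card.index c x , _ , refl , B.trans (f-cong (Card.elem-index c x)) fx≈y
  ... | o , d = subst (HasCardinality B) o≡n/m d
    where
    o≡n/m : o ≡ n / m
    o≡n/m = trans (sym (m*n/n≡m o m)) (cong (_/ m) (card-unique (card-fibred f f-cong d fibres) c))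

module _ {A : Setoid a ℓ} {B : Setoid a′ ℓ′} {C : Setoid a″ ℓ″} where

  private
    module A = Setoid A
    module B = Setoid B
    module C = Setoid C

  card-disjoint : (f : A.Carrier → C.Carrier) → (∀ {x y} → x A.≈ y → f x C.≈ f y) →
                  (∀ {x y} → f x C.≈ f y → x A.≈ y) →
                  (g : B.Carrier → C.Carrier) → (∀ {x y} → x B.≈ y → g x C.≈ g y) →
                  (∀ {x y} → g x C.≈ g y → x B.≈ y) →
                  (∀ x y → ¬ f x C.≈ g y) →
                  (∀ z → (∃[ x ] f x C.≈ z) ⊎ (∃[ y ] g y C.≈ z)) →
                  HasCardinality A m → HasCardinality B n → HasCardinality C (m + n)
  card-disjoint {m = m} {n = n} f f-cong f-inj g g-cong g-inj f≉g cover c d =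
    enumeration⇒card (e ∘ splitAt m)
      (λ {i} {j} → Injection.injective (↔⇒↣ (+↔⊎ {m} {n})) ∘ e-injective {splitAt m i} {splitAt m j}) surj
    where
    e : Fin m ⊎ Fin n → C.Carrier
    e = [ f ∘ Card.elem c , g ∘ Card.elem d ]

    e-injective : ∀ {x y} → e x C.≈ e y → x ≡ y
    e-injective {inj₁ _} {inj₁ _} eq = cong inj₁ (Card.elem-injective c (f-inj eq))
    e-injective {inj₁ _} {inj₂ _} eq = contradiction eq (f≉g _ _)
    e-injective {inj₂ _} {inj₁ _} eq = contradiction (C.sym eq) (f≉g _ _)
    e-injective {inj₂ _} {inj₂ _} eq = cong inj₂ (Card.elem-injective d (g-inj eq))

    surj′ : ∀ z → ∃[ i ] e i C.≈ z
    surj′ z with cover z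
    ... | inj₁ (x , fx≈z) = inj₁ (Card.index c x) , C.trans (f-cong (Card.elem-index c x)) fx≈z
    ... | inj₂ (y , gy≈z) = inj₂ (Card.index d y) , C.trans (g-cong (Card.elem-index d y)) gy≈z

    surj : ∀ z → ∃[ i ] e (splitAt m i) C.≈ z
    surj z = let (i , ei≈z) = surj′ z in
      join m n i , subst (λ j → e j C.≈ z) (sym (splitAt-join m n i)) ei≈z

-- Filtering shows that the complement has some size `o`; as the two parts make up `S`, `m + o ≡ n`.
card-complement : {S : Setoid a ℓ} {P : Pred (Setoid.Carrier S) p} →
                  HasCardinality S n → P Respects Setoid._≈_ S → Unary.Decidable P →
                  HasCardinality (restrict S P) m → HasCardinality (restrict S (∁ P)) (n ∸ m)
card-complement {n = n} {m = m} {S = S} {P = P} c resp P? d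
  with card-restrict {P = ∁ P} c (λ x≈y ¬Px Py → ¬Px (resp (Setoid.sym S x≈y) Py)) (¬? ∘ P?)
... | o , d′ = subst (HasCardinality (restrict S (∁ P))) o≡n∸m d′
  where
  whole : HasCardinality S (m + o)
  whole = card-disjoint {A = restrict S P} {B = restrict S (∁ P)}
    proj₁ id id proj₁ id id
    (λ (x , Px) (y , ¬Py) x≈y → ¬Py (resp x≈y Px))
    (λ z → split z (P? z)) d d′
    where
    split : ∀ z → Dec (P z) → _
    split z (yes Pz) = inj₁ ((z , Pz) , Setoid.refl S)
    split z (no ¬Pz) = inj₂ ((z , ¬Pz) , Setoid.refl S)

  o≡n∸m : o ≡ n ∸ m
  o≡n∸m = trans (sym (m+n∸m≡n m o)) (cong (_∸ m) (card-unique whole c))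

card-injection : ∀ {a ℓ a′ ℓ′ m n} {A : Setoid a ℓ} {B : Setoid a′ ℓ′}
                 (f : Setoid.Carrier A → Setoid.Carrier B) →
                 (∀ {x y} → Setoid._≈_ B (f x) (f y) → Setoid._≈_ A x y) →
                 HasCardinality A m → HasCardinality B n → m ≤ n
card-injection f f-inj c d = injective⇒≤ {f = Card.index d ∘ f ∘ Card.elem c}
  (Card.elem-injective c ∘ f-inj ∘ Card.index-injective d)

-- Lets dimensions be compared through numbers of vectors.
^-cancelʳ-≤ : ∀ {q m n} → 1 < q → q ^ m ≤ q ^ n → m ≤ n
^-cancelʳ-≤ {q} 1<q q^m≤q^n = ≮⇒≥ λ n<m → <⇒≱ (^-monoʳ-< q 1<q n<m) q^m≤q^n

-- Linear algebra over a finite field.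

module _ {q : ℕ} (F : FiniteField q) (1<q : 1 < q) where

  open FiniteField F using (Carrier; _≈_; 0#; 1#)
  private module F = FiniteField F

  ≈-decidable : Decidable _≈_
  ≈-decidable = Card.≈-dec F.cardinality

  -- Invertibility is decidable because F is finite, and by tightness a
  -- non-invertible element is zero.
  leftInverse : ∀ {x} → ¬ x ≈ 0# → ∃[ y ] y F.* x ≈ 1#
  leftInverse {x} x≉0
    with Card.∃-dec F.cardinality (λ y≈z yx≈1 → F.trans (F.*-congʳ (F.sym y≈z)) yx≈1)
           (λ y → ≈-decidable (y F.* x) 1#)
  ... | yes inverse    = inverse
  ... | no ¬invertible = contradiction (proj₁ (tight x 0#) ¬x#0) x≉0
    where
    open HeytingField F.heytingField using (_#_; tight; #⇒invertible)

    x-0≈x : x F.- 0# ≈ x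
    x-0≈x = F.trans (F.+-congˡ (RingProperties.-0#≈0# F.ring)) (F.+-identityʳ x)

    ¬x#0 : ¬ x # 0#
    ¬x#0 x#0 = let (y , yx≈1 , _) = #⇒invertible x#0 in
      ¬invertible (y , F.trans (F.*-congˡ (F.sym x-0≈x)) yx≈1)

  -- Otherwise all elements coincide, and `Fin q` would embed into `Fin 1`.
  1≉0 : ¬ 1# ≈ 0#
  1≉0 1≈0 = <⇒≱ 1<q (injective⇒≤ {f = λ _ → zero {0}} λ _ →
    Card.elem-injective F.cardinality (F.trans (x≈0 _) (F.sym (x≈0 _))))
    where
    x≈0 : ∀ x → x ≈ 0#
    x≈0 x = F.trans (F.sym (F.*-identityˡ x)) (F.trans (F.*-congʳ 1≈0) (F.zeroˡ x))

  module _ (V : VectorSpace F) where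

    open Module V
    open SetoidReasoning ≈ᴹ-setoid

    private
      lc : ∀ {n} → Vector Carrier n → Vector Carrierᴹ n → Carrierᴹ
      lc = linearCombination F V

      interchange : ∀ w x y z → (w +ᴹ x) +ᴹ (y +ᴹ z) ≈ᴹ (w +ᴹ y) +ᴹ (x +ᴹ z)
      interchange = CommutativeSemigroupProperties.interchange
        (record { isCommutativeSemigroup = record { isSemigroup = +ᴹ-isSemigroup ; comm = +ᴹ-comm } })

    -- A `Subspace` is closed under scalars and has no separate field for negation, so differences
    -- within it are formed with the scalar -1.
    -1*x≈-x : ∀ x → F.- 1# *ₗ x ≈ᴹ -ᴹ x
    -1*x≈-x x = LeftModuleProperties.inverseʳ-uniqueᴹ leftModule x _ (begin
      x +ᴹ F.- 1# *ₗ x         ≈⟨ +ᴹ-congʳ (*ₗ-identityˡ x) ⟨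
      1# *ₗ x +ᴹ F.- 1# *ₗ x   ≈⟨ *ₗ-distribʳ x 1# (F.- 1#) ⟨
      (1# F.+ F.- 1#) *ₗ x     ≈⟨ *ₗ-congʳ (F.-‿inverseʳ 1#) ⟩
      0# *ₗ x                  ≈⟨ *ₗ-zeroˡ x ⟩
      0ᴹ                       ∎)

    linearCombination-cong : ∀ {n} {c d : Vector Carrier n} b → (∀ i → c i ≈ d i) → lc c b ≈ᴹ lc d b
    linearCombination-cong {zero}  b c≈d = ≈ᴹ-refl
    linearCombination-cong {suc n} b c≈d =
      +ᴹ-cong (*ₗ-congʳ (c≈d zero)) (linearCombination-cong (b ∘ suc) (c≈d ∘ suc))

    linearCombination-+ : ∀ {n} (c d : Vector Carrier n) b →
                          lc (λ i → c i F.+ d i) b ≈ᴹ lc c b +ᴹ lc d b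
    linearCombination-+ {zero}  c d b = ≈ᴹ-sym (+ᴹ-identityˡ 0ᴹ)
    linearCombination-+ {suc n} c d b = ≈ᴹ-trans
      (+ᴹ-cong (*ₗ-distribʳ _ _ _) (linearCombination-+ (c ∘ suc) (d ∘ suc) (b ∘ suc)))
      (interchange _ _ _ _)

    linearCombination-* : ∀ {n} a (c : Vector Carrier n) b → lc (λ i → a F.* c i) b ≈ᴹ a *ₗ lc c b
    linearCombination-* {zero}  a c b = ≈ᴹ-sym (*ₗ-zeroʳ a)
    linearCombination-* {suc n} a c b = ≈ᴹ-trans
      (+ᴹ-cong (*ₗ-assoc _ _ _) (linearCombination-* a (c ∘ suc) (b ∘ suc)))
      (≈ᴹ-sym (*ₗ-distribˡ a _ _))

    -- Independence is applied to the coefficientwise difference, whose combination vanishes.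
    linearCombination-injective : ∀ {n} {b : Vector Carrierᴹ n} → LinearlyIndependent F V b →
                                  ∀ {c d} → lc c b ≈ᴹ lc d b → ∀ i → c i ≈ d i
    linearCombination-injective {b = b} independent {c} {d} eq i =
      (x+-y≈0⇒x≈y (independent (λ j → c j F.+ F.- 1# F.* d j) difference i))
      where
      difference : lc (λ j → c j F.+ F.- 1# F.* d j) b ≈ᴹ 0ᴹ
      difference = begin
        lc (λ j → c j F.+ F.- 1# F.* d j) b   ≈⟨ linearCombination-+ c _ b ⟩
        lc c b +ᴹ lc (λ j → F.- 1# F.* d j) b ≈⟨ +ᴹ-cong eq (linearCombination-* (F.- 1#) d b) ⟩
        lc d b +ᴹ F.- 1# *ₗ lc d b            ≈⟨ +ᴹ-congˡ (-1*x≈-x _) ⟩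
        lc d b +ᴹ -ᴹ lc d b                   ≈⟨ -ᴹ‿inverseʳ _ ⟩
        0ᴹ                                    ∎

      x+-y≈0⇒x≈y : ∀ {x y} → x F.+ F.- 1# F.* y ≈ 0# → x ≈ y
      x+-y≈0⇒x≈y {x} {y} eq =
        (AbelianGroupProperties.x∙y⁻¹≈ε⇒x≈y F.+-abelianGroup x y
          (F.trans (F.+-congˡ (F.sym (RingProperties.-1*x≈-x F.ring y))) eq))

    module _ (X : Subspace F V) where

      open Subspace X

      linearCombination-closed : ∀ {n} (c : Vector Carrier n) {b} → (∀ i → b i ∈ Member) → lc c b ∈ Member
      linearCombination-closed {zero}  c b∈X = 0-closed
      linearCombination-closed {suc n} c b∈X =
        +-closed (*ₗ-closed _ (b∈X zero)) (linearCombination-closed (c ∘ suc) (b∈X ∘ suc))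

      +-cancelʳ : ∀ {x z} → x +ᴹ z ∈ Member → z ∈ Member → x ∈ Member
      +-cancelʳ {x} {z} x+z∈X z∈X = resp (begin
        (x +ᴹ z) +ᴹ F.- 1# *ₗ z  ≈⟨ +ᴹ-congˡ (-1*x≈-x z) ⟩
        (x +ᴹ z) +ᴹ -ᴹ z         ≈⟨ +ᴹ-assoc x z (-ᴹ z) ⟩
        x +ᴹ (z +ᴹ -ᴹ z)         ≈⟨ +ᴹ-congˡ (-ᴹ‿inverseʳ z) ⟩
        x +ᴹ 0ᴹ                  ≈⟨ +ᴹ-identityʳ x ⟩
        x                        ∎) (+-closed x+z∈X (*ₗ-closed (F.- 1#) z∈X))

      *ₗ-cancel : ∀ {a x} → ¬ a ≈ 0# → a *ₗ x ∈ Member → x ∈ Member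
      *ₗ-cancel {a} {x} a≉0 ax∈X = let (a⁻¹ , a⁻¹a≈1) = leftInverse a≉0 in resp (begin
        a⁻¹ *ₗ a *ₗ x     ≈⟨ *ₗ-assoc a⁻¹ a x ⟨
        (a⁻¹ F.* a) *ₗ x  ≈⟨ *ₗ-congʳ a⁻¹a≈1 ⟩
        1# *ₗ x           ≈⟨ *ₗ-identityˡ x ⟩
        x                 ∎) (*ₗ-closed a⁻¹ ax∈X)

      -- The sum X + ⟨x⟩, with the coefficient of `x` kept explicit so that later proofs can ask
      -- whether it is zero.
      adjoin : Carrierᴹ → Subspace F V
      adjoin x = record
        { Member    = λ y → ∃[ a ] ∃[ z ] z ∈ Member × a *ₗ x +ᴹ z ≈ᴹ y
        ; resp      = λ { y≈y′ (a , z , z∈X , eq) → a , z , z∈X , ≈ᴹ-trans eq y≈y′ }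
        ; 0-closed  = 0# , 0ᴹ , 0-closed , ≈ᴹ-trans (+ᴹ-identityʳ _) (*ₗ-zeroˡ x)
        ; +-closed  = λ { (a , z , z∈X , eq) (a′ , z′ , z′∈X , eq′) →
            a F.+ a′ , z +ᴹ z′ , +-closed z∈X z′∈X ,
            ≈ᴹ-trans (+ᴹ-congʳ (*ₗ-distribʳ x a a′))
              (≈ᴹ-trans (interchange _ _ _ _) (+ᴹ-cong eq eq′)) }
        ; *ₗ-closed = λ { c (a , z , z∈X , eq) → c F.* a , c *ₗ z , *ₗ-closed c z∈X ,
            ≈ᴹ-trans (+ᴹ-congʳ (*ₗ-assoc c a x)) (≈ᴹ-trans (≈ᴹ-sym (*ₗ-distribˡ c _ _)) (*ₗ-congˡ eq)) }
        }

      ⊆-adjoin : ∀ {x} → Member ⊆ Subspace.Member (adjoin x)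
      ⊆-adjoin {x} {z} z∈X = 0# , z , z∈X , ≈ᴹ-trans (+ᴹ-congʳ (*ₗ-zeroˡ x)) (+ᴹ-identityˡ z)

      ∈-adjoin : ∀ {x} → x ∈ Subspace.Member (adjoin x)
      ∈-adjoin {x} = 1# , 0ᴹ , 0-closed , ≈ᴹ-trans (+ᴹ-identityʳ _) (*ₗ-identityˡ x)

      adjoin-least : ∀ {x} (Y : Subspace F V) → Member ⊆ Subspace.Member Y → x ∈ Subspace.Member Y →
                     Subspace.Member (adjoin x) ⊆ Subspace.Member Y
      adjoin-least Y X⊆Y x∈Y (a , z , z∈X , eq) = Y.resp eq (Y.+-closed (Y.*ₗ-closed a x∈Y) (X⊆Y z∈X))
        where module Y = Subspace Y

      -- In a vanishing combination the coefficient of `x` is zero: otherwise it could be divided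
      -- out, and `x` would lie in `X`. What remains is a combination of the old basis.
      adjoin-dimension : ∀ {n x} → OfDimension F V n X → x ∉ Member → OfDimension F V (suc n) (adjoin x)
      adjoin-dimension {x = x} (b , basis) x∉X = x ∷ b , record
        { inside      = λ { zero → ∈-adjoin ; (suc i) → ⊆-adjoin (inside i) }
        ; independent = λ c eq → independent⁺ c eq (≈-decidable (c zero) 0#)
        ; spanning    = λ { (a , z , z∈X , eq) → let (c , z≈cb) = spanning z∈X in
            a ∷ c , ≈ᴹ-trans (≈ᴹ-sym eq) (+ᴹ-congˡ z≈cb) }
        }
        where
        open IsBasis basis

        independent⁺ : ∀ c → lc c (x ∷ b) ≈ᴹ 0ᴹ → Dec (c zero ≈ 0#) → ∀ i → c i ≈ 0#
        independent⁺ c eq (yes c₀≈0) zero    = c₀≈0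
        independent⁺ c eq (yes c₀≈0) (suc i) = independent (c ∘ suc) (begin
          lc (c ∘ suc) b                  ≈⟨ +ᴹ-identityˡ _ ⟨
          0ᴹ +ᴹ lc (c ∘ suc) b            ≈⟨ +ᴹ-congʳ (*ₗ-zeroˡ x) ⟨
          0# *ₗ x +ᴹ lc (c ∘ suc) b       ≈⟨ +ᴹ-congʳ (*ₗ-congʳ c₀≈0) ⟨
          c zero *ₗ x +ᴹ lc (c ∘ suc) b   ≈⟨ eq ⟩
          0ᴹ                              ∎) i
        independent⁺ c eq (no c₀≉0) i = contradiction
          (*ₗ-cancel c₀≉0 (+-cancelʳ (resp (≈ᴹ-sym eq) 0-closed) (linearCombination-closed (c ∘ suc) inside)))
          x∉X

      -- A basis identifies the vectors of `X` with coefficient vectors, and these are numbered as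
      -- functions from `Fin n` to `Fin q`.
      dimension-card : ∀ {n} → OfDimension F V n X → HasCardinality (restrict ≈ᴹ-setoid Member) (q ^ n)
      dimension-card {n} (b , basis) = enumeration⇒card e injective surjective
        where
        open IsBasis basis
        open Card F.cardinality

        e : Fin (q ^ n) → Σ[ x ∈ Carrierᴹ ] x ∈ Member
        e i = _ , linearCombination-closed (elem ∘ finToFun i) inside

        injective : ∀ {i j} → proj₁ (e i) ≈ᴹ proj₁ (e j) → i ≡ j
        injective {i} {j} eq = ≡.trans (≡.sym (funToFin-finToFin {n} i)) (≡.trans
          (funToFin-cong λ l → elem-injective (linearCombination-injective independent eq l))
          (funToFin-finToFin {n} j))
          where
          funToFin-cong : ∀ {m} {f g : Fin m → Fin q} → (∀ l → f l ≡ g l) → funToFin f ≡ funToFin g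
          funToFin-cong {zero}  f≗g = ≡.refl
          funToFin-cong {suc m} f≗g = ≡.cong₂ combine (f≗g zero) (funToFin-cong (f≗g ∘ suc))

        surjective : ∀ y → ∃[ i ] proj₁ (e i) ≈ᴹ proj₁ y
        surjective (y , y∈X) = let (c , y≈cb) = spanning y∈X in
          funToFin (index ∘ c) , ≈ᴹ-trans
            (linearCombination-cong b λ l → F.trans
              (F.reflexive (≡.cong elem (finToFun-funToFin (index ∘ c) l))) (elem-index (c l)))
            (≈ᴹ-sym y≈cb)

    dimension-resp : ∀ {n} (X Y : Subspace F V) → _≈ˢ_ F V X Y → OfDimension F V n X → OfDimension F V n Y
    dimension-resp X Y (X⊆Y , Y⊆X) (b , basis) = b , record
      { inside = X⊆Y ∘ inside ; independent = independent ; spanning = spanning ∘ Y⊆X }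
      where open IsBasis basis

    whole : Subspace F V
    whole = record { Member = U ; resp = λ _ _ → tt ; 0-closed = tt
                   ; +-closed = λ _ _ → tt ; *ₗ-closed = λ _ _ → tt }

    space-card : ∀ {v} → HasDimension F V v U → HasCardinality ≈ᴹ-setoid (q ^ v)
    space-card dim = card-transfer {A = restrict ≈ᴹ-setoid U} proj₁ id id (λ y → (y , tt) , ≈ᴹ-refl)
      (dimension-card whole dim)

  -- Dimension and decidability in a finite vector space.

  module FiniteSpace (V : VectorSpace F) {v : ℕ} (dimV : HasDimension F V v U) where

    open Module V

    private
      Member : Subspace F V → Pred Carrierᴹ 0ℓ
      Member = Subspace.Member

      resp : ∀ X {x y} → x ≈ᴹ y → x ∈ Member X → y ∈ Member X
      resp = Subspace.resp

    cardV : HasCardinality ≈ᴹ-setoid (q ^ v)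
    cardV = space-card V dimV

    -- `Member` is an arbitrary predicate, but a basis turns the subspace into a finite list, which
    -- can be searched for a vector equal to `y`.
    ∈-decidable : ∀ X {n} → OfDimension F V n X → Unary.Decidable (Member X)
    ∈-decidable X dimX y = map′ (λ { ((x , x∈X) , x≈y) → resp X x≈y x∈X }) (λ y∈X → (y , y∈X) , ≈ᴹ-refl)
      (Card.∃-dec (dimension-card V X dimX) {P = λ (x , _) → x ≈ᴹ y} (λ x≈x′ x≈y → ≈ᴹ-trans (≈ᴹ-sym x≈x′) x≈y)
        (λ (x , _) → Card.≈-dec cardV x y))

    ⊆-decidable : ∀ X Y → Unary.Decidable (Member X) → Unary.Decidable (Member Y) → Dec (Member X ⊆ Member Y)
    ⊆-decidable X Y X? Y? = map′ (λ X⊆Y {x} → X⊆Y x) (λ X⊆Y x → X⊆Y)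
      (Card.∀-dec cardV {P = λ x → x ∈ Member X → x ∈ Member Y} (λ x≈y imp y∈X → resp Y x≈y (imp (resp X (≈ᴹ-sym x≈y) y∈X)))
        (λ x → X? x →-dec Y? x))

    ≈ˢ-decidable : ∀ X Y {m n} → OfDimension F V m X → OfDimension F V n Y → Dec (_≈ˢ_ F V X Y)
    ≈ˢ-decidable X Y dimX dimY =
      ⊆-decidable X Y (∈-decidable X dimX) (∈-decidable Y dimY) ×-dec
      ⊆-decidable Y X (∈-decidable Y dimY) (∈-decidable X dimX)

    -- Comparing `q ^ m` vectors with `q ^ n` takes the place of the exchange lemma.
    dimension-mono : ∀ X Y {m n} → Member X ⊆ Member Y → OfDimension F V m X → OfDimension F V n Y → m ≤ n
    dimension-mono X Y X⊆Y dimX dimY = ^-cancelʳ-≤ 1<q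
      (card-injection (λ (x , x∈X) → x , X⊆Y x∈X) id (dimension-card V X dimX) (dimension-card V Y dimY))

    dimension-unique : ∀ X {m n} → OfDimension F V m X → OfDimension F V n X → m ≡ n
    dimension-unique X d d′ = ≤-antisym (dimension-mono X X id d d′) (dimension-mono X X id d′ d)

    dimension-≤ : ∀ X {n} → OfDimension F V n X → n ≤ v
    dimension-≤ X dimX = ^-cancelʳ-≤ 1<q (card-injection proj₁ id (dimension-card V X dimX) cardV)

    -- A vector `y` of `Y` outside `X` would give X + ⟨y⟩, of dimension `suc n`, inside `Y`.
    ⊆⇒⊇ : ∀ X Y {n} → OfDimension F V n X → OfDimension F V n Y → Member X ⊆ Member Y → Member Y ⊆ Member X
    ⊆⇒⊇ X Y dimX dimY X⊆Y {y} y∈Y = decidable-stable (∈-decidable X dimX y) λ y∉X →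
      <-irrefl ≡.refl (dimension-mono (adjoin V X y) Y (adjoin-least V X Y X⊆Y y∈Y)
        (adjoin-dimension V X dimX y∉X) dimY)

    -- Greedy construction of a basis: starting from the zero space, vectors of `X` are adjoined
    -- until none is missing. The fuel bounds the number of further vectors, since no subspace has
    -- dimension above `v`.
    ∃-dimension : ∀ X → Unary.Decidable (Member X) → ∃[ n ] OfDimension F V n X
    ∃-dimension X X? = grow v zeroˢ ([] , zero-basis) (λ x≈0 → resp X (≈ᴹ-sym x≈0) (Subspace.0-closed X)) (m≤m+n v 0)
      where
      zeroˢ : Subspace F V
      zeroˢ = record
        { Member    = _≈ᴹ 0ᴹ
        ; resp      = λ x≈y x≈0 → ≈ᴹ-trans (≈ᴹ-sym x≈y) x≈0
        ; 0-closed  = ≈ᴹ-refl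
        ; +-closed  = λ x≈0 y≈0 → ≈ᴹ-trans (+ᴹ-cong x≈0 y≈0) (+ᴹ-identityˡ 0ᴹ)
        ; *ₗ-closed = λ a x≈0 → ≈ᴹ-trans (*ₗ-congˡ x≈0) (*ₗ-zeroʳ a)
        }

      zero-basis : IsBasis F V (Member zeroˢ) []
      zero-basis = record { inside = λ () ; independent = λ _ _ () ; spanning = λ x≈0 → [] , x≈0 }

      grow : ∀ fuel Y {n} → OfDimension F V n Y → Member Y ⊆ Member X → v ≤ fuel + n → ∃[ n ] OfDimension F V n X
      grow fuel Y {n} dimY Y⊆X enough
        with Card.∃-dec cardV {P = λ x → Member X x × ¬ Member Y x}
               (λ x≈y (x∈X , x∉Y) → resp X x≈y x∈X , λ y∈Y → x∉Y (resp Y (≈ᴹ-sym x≈y) y∈Y))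
               (λ x → X? x ×-dec ¬? (∈-decidable Y dimY x))
      ... | no none = n , dimension-resp V Y X
        (Y⊆X , λ {x} x∈X → decidable-stable (∈-decidable Y dimY x) λ x∉Y → none (x , x∈X , x∉Y)) dimY
      -- With the fuel spent, `v ≤ n`, yet adjoining `x` would give a subspace of dimension `suc n`.
      grow zero Y dimY Y⊆X enough | yes (x , x∈X , x∉Y) = contradiction
        (≤-trans (dimension-≤ (adjoin V Y x) (adjoin-dimension V Y dimY x∉Y)) enough) (<-irrefl ≡.refl)
      grow (suc fuel) Y {n} dimY Y⊆X enough | yes (x , x∈X , x∉Y) =
        grow fuel (adjoin V Y x) (adjoin-dimension V Y dimY x∉Y) (adjoin-least V Y X Y⊆X x∈X)
          (≤-trans enough (≤-reflexive (≡.sym (+-suc fuel n))))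

    outside-card : ∀ X {n} → OfDimension F V n X → HasCardinality (restrict ≈ᴹ-setoid (∁ (Member X))) (q ^ v ∸ q ^ n)
    outside-card X dimX = card-complement cardV (resp X) (∈-decidable X dimX) (dimension-card V X dimX)

    difference : Subspace F V → Subspace F V → Setoid 0ℓ 0ℓ
    difference K X = restrict (restrict ≈ᴹ-setoid (Member K)) (∁ (Member X ∘ proj₁))

    difference-card : ∀ K X {m n} → OfDimension F V m K → OfDimension F V n X → Member X ⊆ Member K →
                      HasCardinality (difference K X) (q ^ m ∸ q ^ n)
    difference-card K X dimK dimX X⊆K = card-complement (dimension-card V K dimK) (resp X)
      (∈-decidable X dimX ∘ proj₁)
      (card-transfer (λ (x , x∈X) → (x , X⊆K x∈X) , x∈X) id id
        (λ ((y , _) , y∈X) → (y , y∈X) , ≈ᴹ-refl) (dimension-card V X dimX))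

    -- Designs of lower strength.

    _≋_ : Subspace F V → Subspace F V → Set
    _≋_ = _≈ˢ_ F V

    ≋-refl : ∀ X → X ≋ X
    ≋-refl X = id , id

    ≋-sym : ∀ X Y → X ≋ Y → Y ≋ X
    ≋-sym X Y (f , g) = g , f

    vector×subspace : Setoid _ _
    vector×subspace = record
      { Carrier = Carrierᴹ × Subspace F V
      ; _≈_     = λ (x , K) (y , L) → x ≈ᴹ y × K ≋ L
      ; isEquivalence = record
        { refl  = λ { {_ , K} → ≈ᴹ-refl , ≋-refl K }
        ; sym   = λ { {_ , K} {_ , L} (x≈y , K≋L) → ≈ᴹ-sym x≈y , ≋-sym K L K≋L }
        ; trans = λ (x≈y , f , g) (y≈z , f′ , g′) → ≈ᴹ-trans x≈y y≈z , f′ ∘ f , g ∘ g′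
        }
      }

    -- The pairs (x , K) with x ∉ S and S + ⟨x⟩ ⊆ K ∈ 𝓑, counted along both projections.
    lower-design : ∀ {t k λ′ 𝓑} .{{_ : NonZero (q ^ k ∸ q ^ t)}} → IsSubspaceDesign F V (suc t) v k λ′ 𝓑 →
                   IsSubspaceDesign F V t v k ((q ^ v ∸ q ^ t) * λ′ / (q ^ k ∸ q ^ t)) 𝓑
    lower-design {t} {k} {λ′} {𝓑} D = record
      { ambient-dimension = ambient-dimension
      ; respects          = respects
      ; block-dimension   = λ {K} → block-dimension {K}
      ; balanced          = balanced′
      }
      where
      open IsSubspaceDesign D

      module _ (S : Subspace F V) (dimS : OfDimension F V t S) where

        Outside : Setoid _ _
        Outside = restrict ≈ᴹ-setoid (∁ (Member S))

        pairs : Setoid _ _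
        pairs = On.setoid {B = Σ[ x ∈ Setoid.Carrier Outside ]
                               Setoid.Carrier (blocksContaining F V 𝓑 (adjoin V S (proj₁ x)))}
          vector×subspace (λ ((x , _) , (K , _)) → x , K)

        pairs-card : HasCardinality pairs ((q ^ v ∸ q ^ t) * λ′)
        pairs-card = card-fibred {A = pairs} {B = Outside} proj₁ proj₁ (outside-card S dimS) λ (x , x∉S) →
          card-transfer {A = blocksContaining F V 𝓑 (adjoin V S x)} {B = fibre pairs Outside proj₁ (x , x∉S)}
            (λ K → ((x , x∉S) , K) , ≈ᴹ-refl) (λ K≋L → ≈ᴹ-refl , K≋L) proj₂
            -- A pair in the fibre carries a vector `y` that is merely equal to `x`, so containment
            -- of S + ⟨x⟩ in `K` is derived anew from that of S + ⟨y⟩.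
            (λ (((y , _) , (K , K∈𝓑 , S+y⊆K)) , y≈x) →
              (K , K∈𝓑 , adjoin-least V S K (S+y⊆K ∘ ⊆-adjoin V S) (resp K y≈x (S+y⊆K (∈-adjoin V S)))) ,
              ≈ᴹ-sym y≈x , ≋-refl K)
            (balanced (adjoin V S x) (adjoin-dimension V S dimS x∉S))

        forgetVector : Setoid.Carrier pairs → Setoid.Carrier (blocksContaining F V 𝓑 S)
        forgetVector (_ , (K , K∈𝓑 , S+x⊆K)) = K , K∈𝓑 , S+x⊆K ∘ ⊆-adjoin V S

        balanced′ : HasCardinality (blocksContaining F V 𝓑 S) ((q ^ v ∸ q ^ t) * λ′ / (q ^ k ∸ q ^ t))
        balanced′ = card-quotient {A = pairs} {B = blocksContaining F V 𝓑 S} forgetVector proj₂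
          (λ (K , K∈𝓑 , _) (L , L∈𝓑 , _) → ≈ˢ-decidable K L (block-dimension {K} K∈𝓑) (block-dimension {L} L∈𝓑))
          pairs-card
          -- Over a block `K` lie exactly the vectors of `K` outside `S`: for each of them S + ⟨x⟩
          -- is contained in `K`.
          λ (K , K∈𝓑 , S⊆K) → card-transfer
            {A = difference K S} {B = fibre pairs (blocksContaining F V 𝓑 S) forgetVector (K , K∈𝓑 , S⊆K)}
            (λ ((x , x∈K) , x∉S) → ((x , x∉S) , (K , K∈𝓑 , adjoin-least V S K S⊆K x∈K)) , ≋-refl K)
            (λ x≈y → x≈y , ≋-refl K) proj₁
            (λ (((x , x∉S) , (L , L∈𝓑 , S+x⊆L)) , (L⊆K , K⊆L)) →
              ((x , L⊆K (S+x⊆L (∈-adjoin V S))) , x∉S) , ≈ᴹ-refl , K⊆L , L⊆K)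
            (difference-card K S (block-dimension {K} K∈𝓑) dimS S⊆K)

    -- Induction on the distance `d` from strength `k`. At strength `k` the only block through `T`
    -- is `T` itself, hence the count 1; each further step lowers the strength by one. The resulting
    -- number never has to be made explicit.
    allBlocks-design : ∀ {k} d t → d + t ≡ k → ∃[ λ′ ] IsSubspaceDesign F V t v k λ′ (OfDimension F V k)
    allBlocks-design {k} zero t ≡.refl = 1 , record
      { ambient-dimension = dimV
      ; respects          = λ {X} {Y} → dimension-resp V X Y
      ; block-dimension   = id
      ; balanced          = λ T dimT → enumeration⇒card {S = blocksContaining F V (OfDimension F V k) T}
          (λ _ → T , dimT , id) (λ { {zero} {zero} _ → ≡.refl ; {suc ()} ; {zero} {suc ()} })
          λ (K , dimK , T⊆K) → zero , T⊆K , ⊆⇒⊇ T K dimT dimK T⊆K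
      }
    allBlocks-design (suc d) t ≡.refl =
      let (λ′ , D) = allBlocks-design d (suc t) (+-suc d t) in
      _ , lower-design {{>-nonZero (m<n⇒0<n∸m (^-monoʳ-< q 1<q (s≤s (m≤n+m t d))))}} D

  -- Linear embeddings and the transport of subspaces along them.

  record Embedding (W V : VectorSpace F) : Set where
    private
      module W = Module W
      module V = Module V
    field
      to        : W.Carrierᴹ → V.Carrierᴹ
      to-cong   : ∀ {x y} → x W.≈ᴹ y → to x V.≈ᴹ to y
      injective : ∀ {x y} → to x V.≈ᴹ to y → x W.≈ᴹ y
      +-homo    : ∀ x y → to (x W.+ᴹ y) V.≈ᴹ to x V.+ᴹ to y
      *ₗ-homo   : ∀ a x → to (a W.*ₗ x) V.≈ᴹ a V.*ₗ to x

    0-homo : to W.0ᴹ V.≈ᴹ V.0ᴹ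
    0-homo = V.≈ᴹ-trans (to-cong (W.≈ᴹ-sym (W.*ₗ-zeroˡ W.0ᴹ)))
      (V.≈ᴹ-trans (*ₗ-homo F.0# W.0ᴹ) (V.*ₗ-zeroˡ _))

    linearCombination-homo : ∀ {n} c (b : Vector W.Carrierᴹ n) →
      to (linearCombination F W c b) V.≈ᴹ linearCombination F V c (to ∘ b)
    linearCombination-homo {zero}  c b = 0-homo
    linearCombination-homo {suc n} c b = V.≈ᴹ-trans (+-homo _ _)
      (V.+ᴹ-cong (*ₗ-homo _ _) (linearCombination-homo (c ∘ suc) (b ∘ suc)))

    image : Subspace F W → Subspace F V
    image L = record
      { Member    = λ y → ∃[ x ] x ∈ L.Member × to x V.≈ᴹ y
      ; resp      = λ { y≈y′ (x , x∈L , eq) → x , x∈L , V.≈ᴹ-trans eq y≈y′ }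
      ; 0-closed  = W.0ᴹ , L.0-closed , 0-homo
      ; +-closed  = λ { (x , x∈L , eq) (x′ , x′∈L , eq′) → x W.+ᴹ x′ , L.+-closed x∈L x′∈L ,
          V.≈ᴹ-trans (+-homo x x′) (V.+ᴹ-cong eq eq′) }
      ; *ₗ-closed = λ { a (x , x∈L , eq) → a W.*ₗ x , L.*ₗ-closed a x∈L ,
          V.≈ᴹ-trans (*ₗ-homo a x) (V.*ₗ-congˡ eq) }
      }
      where module L = Subspace L

    preimage : Subspace F V → Subspace F W
    preimage K = record
      { Member    = K.Member ∘ to
      ; resp      = K.resp ∘ to-cong
      ; 0-closed  = K.resp (V.≈ᴹ-sym 0-homo) K.0-closed
      ; +-closed  = λ x∈K y∈K → K.resp (V.≈ᴹ-sym (+-homo _ _)) (K.+-closed x∈K y∈K)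
      ; *ₗ-closed = λ a x∈K → K.resp (V.≈ᴹ-sym (*ₗ-homo a _)) (K.*ₗ-closed a x∈K)
      }
      where module K = Subspace K

    range : Subspace F V
    range = image (whole W)

    image-mono : ∀ L M → _⊆ˢ_ F W L M → _⊆ˢ_ F V (image L) (image M)
    image-mono L M L⊆M (x , x∈L , eq) = x , L⊆M x∈L , eq

    image⊆range : ∀ L → _⊆ˢ_ F V (image L) range
    image⊆range L (x , _ , eq) = x , tt , eq

    preimage-image : ∀ L → _≈ˢ_ F W (preimage (image L)) L
    preimage-image L = (λ { (x , x∈L , eq) → Subspace.resp L (injective eq) x∈L }) , λ x∈L → _ , x∈L , V.≈ᴹ-refl

    image-preimage : ∀ K → _⊆ˢ_ F V K range → _≈ˢ_ F V (image (preimage K)) K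
    image-preimage K K⊆range = (λ { (x , x∈K , eq) → Subspace.resp K eq x∈K }) , λ y∈K →
      let (x , _ , eq) = K⊆range y∈K in x , Subspace.resp K (V.≈ᴹ-sym eq) y∈K , eq

    image-dimension : ∀ L {n} → OfDimension F W n L → OfDimension F V n (image L)
    image-dimension L (b , basis) = to ∘ b , record
      { inside      = λ i → b i , inside i , V.≈ᴹ-refl
      ; independent = λ c eq → independent c (injective
          (V.≈ᴹ-trans (linearCombination-homo c b) (V.≈ᴹ-trans eq (V.≈ᴹ-sym 0-homo))))
      ; spanning    = λ { (x , x∈L , eq) → let (c , x≈cb) = spanning x∈L in
          c , V.≈ᴹ-trans (V.≈ᴹ-sym eq) (V.≈ᴹ-trans (to-cong x≈cb) (linearCombination-homo c b)) }
      }
      where open IsBasis basis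

    module _ {v w} (dimV : HasDimension F V v U) (dimW : HasDimension F W w U) where

      -- The preimage has some dimension, which its image shares. As `K` lies in the range, that
      -- image is `K`, and dimension is unique.
      preimage-dimension : ∀ K {n} → _⊆ˢ_ F V K range → OfDimension F V n K → OfDimension F W n (preimage K)
      preimage-dimension K {n} K⊆range dimK
        with FiniteSpace.∃-dimension W dimW (preimage K) (λ x → FiniteSpace.∈-decidable V dimV K dimK (to x))
      ... | m , dimL = ≡.subst (λ m → OfDimension F W m (preimage K)) m≡n dimL
        where
        m≡n : m ≡ n
        m≡n = FiniteSpace.dimension-unique V dimV K
          (dimension-resp V (image (preimage K)) K (image-preimage K K⊆range) (image-dimension (preimage K) dimL)) dimK

  _∘ᴱ_ : ∀ {U V W : VectorSpace F} → Embedding V W → Embedding U V → Embedding U W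
  _∘ᴱ_ {W = W} f g = record
    { to        = f.to ∘ g.to
    ; to-cong   = f.to-cong ∘ g.to-cong
    ; injective = g.injective ∘ f.injective
    ; +-homo    = λ x y → ≈ᴹ-trans (f.to-cong (g.+-homo x y)) (f.+-homo _ _)
    ; *ₗ-homo   = λ a x → ≈ᴹ-trans (f.to-cong (g.*ₗ-homo a x)) (f.*ₗ-homo a _)
    }
    where
    open Module W using (≈ᴹ-trans)
    module f = Embedding f
    module g = Embedding g

  -- Identification of two spaces of equal dimension.

  module _ {n} (W W′ : VectorSpace F)
           (dimW : HasDimension F W n U) (dimW′ : HasDimension F W′ n U) where

    private
      module W = Module W
      module W′ = Module W′
      module B = IsBasis (proj₂ dimW)
      module B′ = IsBasis (proj₂ dimW′)
      b = proj₁ dimW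
      b′ = proj₁ dimW′

      coordinates : W.Carrierᴹ → Vector F.Carrier n
      coordinates x = proj₁ (B.spanning {x} tt)

      x≈coordinates : ∀ x → x W.≈ᴹ linearCombination F W (coordinates x) b
      x≈coordinates x = proj₂ (B.spanning {x} tt)

      φ : W.Carrierᴹ → W′.Carrierᴹ
      φ x = linearCombination F W′ (coordinates x) b′

      -- By independence `φ` may be computed from any coordinates of `x`, not only from those chosen
      -- by `spanning`. Congruence, linearity and surjectivity of `φ` rest on this.
      φ-lc : ∀ {x} c → x W.≈ᴹ linearCombination F W c b → φ x W′.≈ᴹ linearCombination F W′ c b′
      φ-lc {x} c x≈cb = linearCombination-cong W′ b′
        (linearCombination-injective W B.independent (W.≈ᴹ-trans (W.≈ᴹ-sym (x≈coordinates x)) x≈cb))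

    equidimensional : Embedding W W′
    equidimensional = record
      { to        = φ
      ; to-cong   = λ {x} {y} x≈y → φ-lc (coordinates y) (W.≈ᴹ-trans x≈y (x≈coordinates y))
      ; injective = λ {x} {y} φx≈φy → W.≈ᴹ-trans (x≈coordinates x) (W.≈ᴹ-trans
          (linearCombination-cong W b (linearCombination-injective W′ B′.independent φx≈φy))
          (W.≈ᴹ-sym (x≈coordinates y)))
      ; +-homo    = λ x y → W′.≈ᴹ-trans
          (φ-lc (λ i → coordinates x i F.+ coordinates y i) (W.≈ᴹ-trans
            (W.+ᴹ-cong (x≈coordinates x) (x≈coordinates y))
            (W.≈ᴹ-sym (linearCombination-+ W (coordinates x) (coordinates y) b))))
          (linearCombination-+ W′ (coordinates x) (coordinates y) b′)
      ; *ₗ-homo   = λ a x → W′.≈ᴹ-trans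
          (φ-lc (λ i → a F.* coordinates x i) (W.≈ᴹ-trans
            (W.*ₗ-congˡ (x≈coordinates x)) (W.≈ᴹ-sym (linearCombination-* W a (coordinates x) b))))
          (linearCombination-* W′ a (coordinates x) b′)
      }

    equidimensional-surjective : ∀ y → ∃[ x ] Embedding.to equidimensional x W′.≈ᴹ y
    equidimensional-surjective y = let (c , y≈cb′) = B′.spanning {y} tt in
      linearCombination F W c b , W′.≈ᴹ-trans (φ-lc c W.≈ᴹ-refl) (W′.≈ᴹ-sym y≈cb′)

  -- Adding one coordinate to a vector space.

  module _ (W : VectorSpace F) where

    private
      module W = Module W

    F×_ : VectorSpace F
    F×_ = DirectProduct.⟨module⟩ TensorUnit.⟨module⟩ W

    ι : Embedding W F×_
    ι = record
      { to        = F.0# ,_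
      ; to-cong   = F.refl ,_
      ; injective = proj₂
      ; +-homo    = λ x y → F.sym (F.+-identityˡ F.0#) , W.≈ᴹ-refl
      ; *ₗ-homo   = λ a x → F.sym (F.zeroʳ a) , W.≈ᴹ-refl
      }

    -- The vector (1, 0) lies outside the hyperplane of first coordinate zero, and adjoining it
    -- gives everything.
    F×-dimension : ∀ {n} → HasDimension F W n U → HasDimension F F×_ (suc n) U
    F×-dimension dimW = dimension-resp F×_ (adjoin F×_ range (F.1# , W.0ᴹ)) (whole F×_) (_ , all)
      (adjoin-dimension F×_ range (image-dimension (whole W) dimW)
        λ (_ , _ , 0≈1 , _) → 1≉0 (F.sym 0≈1))
      where
      open Embedding ι
      all : _⊆ˢ_ F F×_ (whole F×_) (adjoin F×_ range (F.1# , W.0ᴹ))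
      all {a , x} _ = a , (F.0# , x) , (x , tt , F.refl , W.≈ᴹ-refl) ,
        F.trans (F.+-identityʳ _) (F.*-identityʳ a) ,
        W.≈ᴹ-trans (W.+ᴹ-congʳ (W.*ₗ-zeroʳ a)) (W.+ᴹ-identityˡ x)

  q^n∸q^m≢0 : ∀ {m n} → m < n → NonZero (q ^ n ∸ q ^ m)
  q^n∸q^m≢0 m<n = >-nonZero (m<n⇒0<n∸m (^-monoʳ-< q 1<q m<n))

  -- Subspaces in relation to a hyperplane.

  module HyperplaneSection
    (V W₁ W₂ : VectorSpace F) {v : ℕ}
    (dimV : HasDimension F V (suc v) U) (dim₁ : HasDimension F W₁ v U) (dim₂ : HasDimension F W₂ v U)
    (ι₁ : Embedding W₁ V) (ι₂ : Embedding W₂ V)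
    (same-range : _≈ˢ_ F V (Embedding.range ι₁) (Embedding.range ι₂)) where

    open Module V

    private
      module V = FiniteSpace V dimV
      module W₁ = FiniteSpace W₁ dim₁
      module W₂ = FiniteSpace W₂ dim₂
      module ι₁ = Embedding ι₁
      module ι₂ = Embedding ι₂

      _⊑_ = _⊆ˢ_ F V
      _≋_ = _≈ˢ_ F V
      _≋₁_ = _≈ˢ_ F W₁
      infix 4 _⊑_ _≋_ _≋₁_

      Member : Subspace F V → Pred Carrierᴹ 0ℓ
      Member = Subspace.Member

    H : Subspace F V
    H = ι₁.range

    H-dimension : OfDimension F V v H
    H-dimension = ι₁.image-dimension (whole W₁) dim₁

    ∈H-decidable : ∀ x → Dec (x ∈ Member H)
    ∈H-decidable = V.∈-decidable H H-dimension

    -- H + ⟨x⟩ already has the full dimension `suc v`.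
    H-maximal : ∀ {x} → x ∉ Member H → whole V ⊑ adjoin V H x
    H-maximal {x} x∉H {y} = V.⊆⇒⊇ (adjoin V H x) (whole V) (adjoin-dimension V H H-dimension x∉H) dimV (λ _ → tt) {y}

    -- A witness is kept rather than the negation of `K ⊑ H`, because `K` is rebuilt from its
    -- section with `H` and such a vector.
    Crossing : Subspace F V → Set
    Crossing K = ∃[ x ] x ∈ Member K × x ∉ Member H

    crossing-or-inside : ∀ K {n} → OfDimension F V n K → Crossing K ⊎ K ⊑ H
    crossing-or-inside K dimK
      with Card.∃-dec V.cardV {P = λ x → x ∈ Member K × x ∉ Member H}
             (λ x≈y (x∈K , x∉H) → Subspace.resp K x≈y x∈K , λ y∈H → x∉H (Subspace.resp H (≈ᴹ-sym x≈y) y∈H))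
             (λ x → V.∈-decidable K dimK x ×-dec ¬? (∈H-decidable x))
    ... | yes crossing = inj₁ crossing
    ... | no ¬crossing = inj₂ λ {x} x∈K → decidable-stable (∈H-decidable x) λ x∉H → ¬crossing (x , x∈K , x∉H)

    crossing-resp : ∀ {K L} → K ≋ L → Crossing K → Crossing L
    crossing-resp (K⊆L , _) (x , x∈K , x∉H) = x , K⊆L x∈K , x∉H

    span : Subspace F W₁ → Carrierᴹ → Subspace F V
    span L x = adjoin V (ι₁.image L) x

    span-mono : ∀ L M x → _⊆ˢ_ F W₁ L M → span L x ⊑ span M x
    span-mono L M x L⊆M = adjoin-least V (ι₁.image L) (span M x)
      (⊆-adjoin V (ι₁.image M) ∘ ι₁.image-mono L M L⊆M) (∈-adjoin V (ι₁.image M))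

    span-cong : ∀ L M x → L ≋₁ M → span L x ≋ span M x
    span-cong L M x (L⊆M , M⊆L) = span-mono L M x L⊆M , span-mono M L x M⊆L

    span-resp : ∀ L {x y} → x ≈ᴹ y → span L x ⊑ span L y
    span-resp L {x} {y} x≈y = adjoin-least V (ι₁.image L) (span L y) (⊆-adjoin V (ι₁.image L))
      (Subspace.resp (span L y) (≈ᴹ-sym x≈y) (∈-adjoin V (ι₁.image L)))

    span-crossing : ∀ L {x} → x ∉ Member H → Crossing (span L x)
    span-crossing L {x} x∉H = x , ∈-adjoin V (ι₁.image L) , x∉H

    -- K = (K ∩ H) + ⟨x⟩: a vector of `K` has the form a x + z with z in `H`, by maximality of `H`,
    -- and then z lies in `K` too, being a difference of vectors of `K`.
    span-preimage : ∀ K {x} → x ∈ Member K → x ∉ Member H → span (ι₁.preimage K) x ≋ K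
    span-preimage K {x} x∈K x∉H =
      adjoin-least V (ι₁.image (ι₁.preimage K)) K (λ { (w , w∈K , eq) → Subspace.resp K eq w∈K }) x∈K ,
      λ {y} y∈K → split y∈K (H-maximal x∉H {y} tt)
      where
      split : ∀ {y} → y ∈ Member K → y ∈ Member (adjoin V H x) → y ∈ Member (span (ι₁.preimage K) x)
      split y∈K (a , z , (w , _ , w≈z) , eq) = a , z , (w , Subspace.resp K (≈ᴹ-sym w≈z) z∈K , w≈z) , eq
        where
        z∈K : z ∈ Member K
        z∈K = +-cancelʳ V K (Subspace.resp K (≈ᴹ-trans (≈ᴹ-sym eq) (+ᴹ-comm _ _)) y∈K) (Subspace.*ₗ-closed K a x∈K)

    -- (L + ⟨x⟩) ∩ H = L: a vector of `H` with nonzero coefficient at `x` would put `x` into `H`.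
    preimage-span : ∀ L {x} → x ∉ Member H → ι₁.preimage (span L x) ≋₁ L
    preimage-span L {x} x∉H =
      (λ { (a , z , (w , w∈L , w≈z) , eq) → Subspace.resp L (ι₁.injective (collapse a w≈z eq (≈-decidable a 0#))) w∈L }) ,
      λ w∈L → ⊆-adjoin V (ι₁.image L) (_ , w∈L , ≈ᴹ-refl)
      where
      collapse : ∀ a {w z y} → ι₁.to w ≈ᴹ z → a *ₗ x +ᴹ z ≈ᴹ ι₁.to y → Dec (a ≈ 0#) → ι₁.to w ≈ᴹ ι₁.to y
      collapse a {w} {z} w≈z eq (yes a≈0) = ≈ᴹ-trans w≈z (≈ᴹ-trans
        (≈ᴹ-sym (≈ᴹ-trans (+ᴹ-congʳ (≈ᴹ-trans (*ₗ-congʳ a≈0) (*ₗ-zeroˡ x))) (+ᴹ-identityˡ z))) eq)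
      collapse a {w} {z} {y} w≈z eq (no a≉0) = contradiction
        (*ₗ-cancel V H a≉0 (+-cancelʳ V H (y , tt , ≈ᴹ-sym eq) (w , tt , w≈z))) x∉H

    span-dimension : ∀ L {n x} → OfDimension F W₁ n L → x ∉ Member H → OfDimension F V (suc n) (span L x)
    span-dimension L dimL x∉H = adjoin-dimension V (ι₁.image L) (ι₁.image-dimension L dimL)
      (x∉H ∘ ι₁.image⊆range L)

    -- K ∩ H has some dimension `m`, and K = (K ∩ H) + ⟨x⟩ then has dimension `suc m`. The equation
    -- for `n` is returned so that callers can match on it.
    crossing-dimension : ∀ K {n} → Crossing K → OfDimension F V n K →
                         ∃[ m ] n ≡ suc m × OfDimension F W₁ m (ι₁.preimage K)
    crossing-dimension K {n} (x , x∈K , x∉H) dimK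
      with W₁.∃-dimension (ι₁.preimage K) (λ w → V.∈-decidable K dimK (ι₁.to w))
    ... | m , dimL = m , n≡1+m , dimL
      where
      n≡1+m : n ≡ suc m
      n≡1+m = V.dimension-unique K dimK (dimension-resp V (span (ι₁.preimage K) x) K
        (span-preimage K x∈K x∉H) (span-dimension (ι₁.preimage K) dimL x∉H))

    inside-dimension : ∀ K {n} → K ⊑ H → OfDimension F V n K → OfDimension F W₂ n (ι₂.preimage K)
    inside-dimension K K⊆H = ι₂.preimage-dimension dimV dim₂ K (proj₁ same-range ∘ K⊆H)

    -- The combined block set and the number of its blocks through a subspace.

    module Union
      {t k λ₁ λ₂ : ℕ} {𝓑₁ : Pred (Subspace F W₁) 0ℓ} {𝓑₂ : Pred (Subspace F W₂) 0ℓ}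
      (D₁ : IsSubspaceDesign F W₁ t v k λ₁ 𝓑₁) (D₂ : IsSubspaceDesign F W₂ t v (suc k) λ₂ 𝓑₂) where

      private
        module D₁ = IsSubspaceDesign D₁
        module D₂ = IsSubspaceDesign D₂

      𝓑 : Pred (Subspace F V) 0ℓ
      𝓑 K = (K ⊑ H × ι₂.preimage K ∈ 𝓑₂) ⊎ (Crossing K × ι₁.preimage K ∈ 𝓑₁)

      𝓑-respects : ∀ {K L} → K ≋ L → K ∈ 𝓑 → L ∈ 𝓑
      𝓑-respects {K} {L} (K⊆L , L⊆K) (inj₁ (K⊆H , K∈)) =
        inj₁ (K⊆H ∘ L⊆K , D₂.respects {ι₂.preimage K} {ι₂.preimage L} (K⊆L , L⊆K) K∈)
      𝓑-respects {K} {L} (K⊆L , L⊆K) (inj₂ (crossing , K∈)) =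
        inj₂ (crossing-resp {K} {L} (K⊆L , L⊆K) crossing ,
              D₁.respects {ι₁.preimage K} {ι₁.preimage L} (K⊆L , L⊆K) K∈)

      𝓑-dimension : ∀ K → K ∈ 𝓑 → OfDimension F V (suc k) K
      𝓑-dimension K (inj₁ (K⊆H , K∈)) = dimension-resp V (ι₂.image (ι₂.preimage K)) K
        (ι₂.image-preimage K (proj₁ same-range ∘ K⊆H))
        (ι₂.image-dimension (ι₂.preimage K) (D₂.block-dimension {ι₂.preimage K} K∈))
      𝓑-dimension K (inj₂ ((x , x∈K , x∉H) , K∈)) = dimension-resp V (span (ι₁.preimage K) x) K
        (span-preimage K x∈K x∉H)
        (span-dimension (ι₁.preimage K) (D₁.block-dimension {ι₁.preimage K} K∈) x∉H)

      span∈𝓑 : ∀ L {x} → x ∉ Member H → L ∈ 𝓑₁ → span L x ∈ 𝓑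
      span∈𝓑 L {x} x∉H L∈ = inj₂ (span-crossing L x∉H ,
        D₁.respects {L} {ι₁.preimage (span L x)} (W₁.≋-sym (ι₁.preimage (span L x)) L (preimage-span L x∉H)) L∈)

      module _ (T : Subspace F V) where

        private
          blocks : Setoid _ _
          blocks = blocksContaining F V 𝓑 T

          S₁ : Subspace F W₁
          S₁ = ι₁.preimage T

          S₂ : Subspace F W₂
          S₂ = ι₂.preimage T

          blocks₁ : Setoid _ _
          blocks₁ = blocksContaining F W₁ 𝓑₁ S₁

          blocks₂ : Setoid _ _
          blocks₂ = blocksContaining F W₂ 𝓑₂ S₂

        -- With `x` in `T` outside `H` fixed, adding ⟨x⟩ and intersecting with `H` are mutually
        -- inverse between the blocks of `D₁` through T ∩ H and the blocks through `T`. No block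
        -- through `T` lies inside `H`.
        crossing-card : ∀ {λ′} → Crossing T → HasCardinality blocks₁ λ′ → HasCardinality blocks λ′
        crossing-card (x , x∈T , x∉H) = card-transfer {A = blocks₁} {B = blocks}
          (λ (L , L∈ , S₁⊆L) → span L x , span∈𝓑 L x∉H L∈ ,
            span-mono S₁ L x S₁⊆L ∘ proj₂ (span-preimage T x∈T x∉H))
          (λ { {L , _} {M , _} L≋M → span-cong L M x L≋M })
          (λ { {L , _} {M , _} (L⊆M , M⊆L) →
            let (L⊇ , L⊆) = preimage-span L x∉H ; (M⊇ , M⊆) = preimage-span M x∉H in
            (λ w∈L → M⊇ (L⊆M (L⊆ w∈L))) , (λ w∈M → L⊇ (M⊆L (M⊆ w∈M))) })
          λ { (K , inj₁ (K⊆H , _) , T⊆K) → contradiction (K⊆H (T⊆K x∈T)) x∉H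
            ; (K , inj₂ (_ , K∈) , T⊆K) → (ι₁.preimage K , K∈ , T⊆K) , span-preimage K (T⊆K x∈T) x∉H }

        module _ (T⊆H : T ⊑ H) where

          private
            Outside : Setoid _ _
            Outside = restrict ≈ᴹ-setoid (∁ (Member H))

            pairs : Setoid _ _
            pairs = ×-setoid Outside blocks₁

            crossingBlocks : Setoid _ _
            crossingBlocks = restrict blocks (λ (K , _) → Crossing K)

            T⊆span : ∀ L {x} → _⊆ˢ_ F W₁ S₁ L → T ⊑ span L x
            T⊆span L S₁⊆L y∈T = let (w , _ , w≈y) = T⊆H y∈T in
              ⊆-adjoin V (ι₁.image L) (w , S₁⊆L (Subspace.resp T (≈ᴹ-sym w≈y) y∈T) , w≈y)

            spanPair : Setoid.Carrier pairs → Setoid.Carrier crossingBlocks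
            spanPair ((x , x∉H) , (L , L∈ , S₁⊆L)) =
              (span L x , span∈𝓑 L x∉H L∈ , T⊆span L S₁⊆L) , span-crossing L x∉H

            pairs-card : HasCardinality blocks₁ λ₁ → HasCardinality pairs ((q ^ suc v ∸ q ^ v) * λ₁)
            pairs-card c = card-fibred {A = pairs} {B = Outside} proj₁ proj₁ (V.outside-card H H-dimension) λ x →
              card-transfer {A = blocks₁} {B = fibre pairs Outside proj₁ x}
                (λ L → (x , L) , ≈ᴹ-refl) (λ L≋M → ≈ᴹ-refl , L≋M) proj₂
                (λ ((y , L) , y≈x) → L , ≈ᴹ-sym y≈x , id , id) c

            -- The pairs that yield `K` have second entry K ∩ H and first entry any vector of `K`
            -- outside `H`; below, `X` is K ∩ H regarded as a subspace of `V`.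
            spanPair-fibre : ∀ K → HasCardinality (fibre pairs crossingBlocks spanPair K) (q ^ suc k ∸ q ^ k)
            spanPair-fibre ((K , inj₁ (K⊆H , _) , _) , (x , x∈K , x∉H)) = contradiction (K⊆H x∈K) x∉H
            spanPair-fibre K⁺@((K , inj₂ (_ , K∈) , T⊆K) , _) = card-transfer
              {A = V.difference K X} {B = fibre pairs crossingBlocks spanPair K⁺}
              (λ ((x , x∈K) , x∉X) →
                ((x , x∉X ∘ section x∈K) , (L , K∈ , T⊆K)) , span-preimage K x∈K (x∉X ∘ section x∈K))
              (λ x≈y → x≈y , id , id) proj₁
              -- Intersecting M + ⟨x⟩ = K with `H` forces M = K ∩ H, so `x` alone determines the
              -- pair.
              (λ { (((x , x∉H) , (M , M∈ , _)) , (M+x⊆K , K⊆M+x)) →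
                ((x , M+x⊆K (∈-adjoin V (ι₁.image M))) , x∉H ∘ ι₁.image⊆range L) ,
                ≈ᴹ-refl ,
                (λ w∈L → proj₁ (preimage-span M x∉H) (K⊆M+x w∈L)) ,
                (λ w∈M → M+x⊆K (proj₂ (preimage-span M x∉H) w∈M)) })
              (V.difference-card K X (𝓑-dimension K (inj₂ (proj₂ K⁺ , K∈)))
                (ι₁.image-dimension L (D₁.block-dimension {L} K∈))
                (λ { (w , w∈K , eq) → Subspace.resp K eq w∈K }))
              where
              L : Subspace F W₁
              L = ι₁.preimage K
              X : Subspace F V
              X = ι₁.image L
              section : ∀ {x} → x ∈ Member K → x ∈ Member H → x ∈ Member X
              section x∈K (w , _ , w≈x) = w , Subspace.resp K (≈ᴹ-sym w≈x) x∈K , w≈x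

            crossingBlocks-card : HasCardinality blocks₁ λ₁ →
              HasCardinality crossingBlocks (_/_ ((q ^ suc v ∸ q ^ v) * λ₁) (q ^ suc k ∸ q ^ k)
                                              {{q^n∸q^m≢0 (n<1+n k)}})
            crossingBlocks-card c = card-quotient {A = pairs} {B = crossingBlocks}
              {{q^n∸q^m≢0 (n<1+n k)}} spanPair
              (λ { {(x , _) , (L , _)} {(y , _) , (M , _)} (x≈y , L≋M) →
                (λ z∈ → span-resp M x≈y (span-mono L M x (proj₁ L≋M) z∈)) ,
                (λ z∈ → span-mono M L x (proj₂ L≋M) (span-resp M (≈ᴹ-sym x≈y) z∈)) })
              (λ ((K , K∈ , _) , _) ((L , L∈ , _) , _) → V.≈ˢ-decidable K L (𝓑-dimension K K∈) (𝓑-dimension L L∈))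
              (pairs-card c) spanPair-fibre

          -- A block through `T` either lies in `H`, where it is the image under `ι₂` of a block of
          -- `D₂`, or crosses `H`, and never both.
          inside-card : HasCardinality blocks₁ λ₁ → HasCardinality blocks₂ λ₂ →
            HasCardinality blocks (λ₂ + _/_ ((q ^ suc v ∸ q ^ v) * λ₁) (q ^ suc k ∸ q ^ k) {{q^n∸q^m≢0 (n<1+n k)}})
          inside-card c₁ c₂ = card-disjoint {A = blocks₂} {B = crossingBlocks} {C = blocks}
            imageBlock
            (λ { {L , _} {M , _} (L⊆M , M⊆L) → ι₂.image-mono L M L⊆M , ι₂.image-mono M L M⊆L })
            (λ { {L , _} {M , _} (L⊆M , M⊆L) →
              let (L⊇ , L⊆) = ι₂.preimage-image L ; (M⊇ , M⊆) = ι₂.preimage-image M in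
              (λ w∈L → M⊇ (L⊆M (L⊆ w∈L))) , (λ w∈M → L⊇ (M⊆L (M⊆ w∈M))) })
            proj₁ id id
            (λ (L , _) (_ , (x , x∈K , x∉H)) (_ , K⊆L) → x∉H (image₂⊆H L (K⊆L x∈K)))
            (λ { (K , inj₁ (K⊆H , K∈) , T⊆K) →
                   inj₁ ((ι₂.preimage K , K∈ , T⊆K) , ι₂.image-preimage K (proj₁ same-range ∘ K⊆H))
               ; K@(K′ , inj₂ (crossing , K∈) , T⊆K) → inj₂ ((K , crossing) , id , id) })
            c₂ (crossingBlocks-card c₁)
            where
            image₂⊆H : ∀ L → ι₂.image L ⊑ H
            image₂⊆H L = proj₂ same-range ∘ ι₂.image⊆range L

            imageBlock : Setoid.Carrier blocks₂ → Setoid.Carrier blocks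
            imageBlock (L , L∈ , S₂⊆L) = ι₂.image L ,
              inj₁ (image₂⊆H L , D₂.respects {L} {ι₂.preimage (ι₂.image L)}
                (W₂.≋-sym (ι₂.preimage (ι₂.image L)) L (ι₂.preimage-image L)) L∈) ,
              ι₂.image-mono S₂ L S₂⊆L ∘ proj₂ (ι₂.image-preimage T (proj₁ same-range ∘ T⊆H))

    -- The number `n` is fixed before the two designs are given, so it cannot depend on which part
    -- of the large sets they come from.
    UniformCard : (t k λ₁ λ₂ : ℕ) → Subspace F V → ℕ → Set₁
    UniformCard t k λ₁ λ₂ T n = ∀ 𝓑₁ 𝓑₂ →
      (D₁ : IsSubspaceDesign F W₁ t v k λ₁ 𝓑₁) (D₂ : IsSubspaceDesign F W₂ t v (suc k) λ₂ 𝓑₂) →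
      HasCardinality (blocksContaining F V (Union.𝓑 {𝓑₁ = 𝓑₁} {𝓑₂ = 𝓑₂} D₁ D₂) T) n

    uniform-inside : ∀ {t k λ₁ λ₂} T → T ⊑ H → OfDimension F V t T → ∃[ n ] UniformCard t k λ₁ λ₂ T n
    uniform-inside T T⊆H dimT = _ , λ 𝓑₁ 𝓑₂ D₁ D₂ → Union.inside-card {𝓑₁ = 𝓑₁} {𝓑₂ = 𝓑₂} D₁ D₂ T T⊆H
      (IsSubspaceDesign.balanced D₁ (ι₁.preimage T) dimS₁)
      (IsSubspaceDesign.balanced D₂ (ι₂.preimage T) dimS₂)
      where
      dimS₁ = ι₁.preimage-dimension dimV dim₁ T T⊆H dimT
      dimS₂ = inside-dimension T T⊆H dimT

    -- T ∩ H has one dimension less than `T`, so `D₁` is used with strength `t` instead of `suc t`;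
    -- `t < k` keeps the divisor nonzero. The lowered count depends on the parameters alone and thus
    -- serves every `D₁`.
    uniform-crossing : ∀ {t k λ₁ λ₂} T → t < k → Crossing T → OfDimension F W₁ t (ι₁.preimage T) →
                       ∃[ n ] UniformCard (suc t) k λ₁ λ₂ T n
    uniform-crossing {t} {k} T t<k crossing dimS₁ = _ , λ 𝓑₁ 𝓑₂ D₁ D₂ →
      Union.crossing-card {𝓑₁ = 𝓑₁} {𝓑₂ = 𝓑₂} D₁ D₂ T crossing (balanced (lowered D₁))
      where
      instance
        _ = q^n∸q^m≢0 t<k

      lowered : ∀ {λ₁ 𝓑₁} → IsSubspaceDesign F W₁ (suc t) v k λ₁ 𝓑₁ →
                IsSubspaceDesign F W₁ t v k ((q ^ v ∸ q ^ t) * λ₁ / (q ^ k ∸ q ^ t)) 𝓑₁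
      lowered D₁ = W₁.lower-design D₁

      balanced : ∀ {λ₁ 𝓑₁} → IsSubspaceDesign F W₁ t v k λ₁ 𝓑₁ →
                 HasCardinality (blocksContaining F W₁ 𝓑₁ (ι₁.preimage T)) λ₁
      balanced D₁ = IsSubspaceDesign.balanced D₁ (ι₁.preimage T) dimS₁

    uniform-card : ∀ {t k λ₁ λ₂} T → t ≤ k → OfDimension F V t T → ∃[ n ] UniformCard t k λ₁ λ₂ T n
    uniform-card {t} {k} {λ₁} {λ₂} T t≤k dimT = by-cases (crossing-or-inside T dimT)
      where
      -- `t` is quantified afresh so that `t ≡ suc m` can be matched; the bound `t ≤ k` then reads
      -- `m < k`.
      crossing-case : ∀ {t} → t ≤ k → Crossing T → ∃[ m ] t ≡ suc m × OfDimension F W₁ m (ι₁.preimage T) →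
                      ∃[ n ] UniformCard t k λ₁ λ₂ T n
      crossing-case m<k crossing (_ , ≡.refl , dimS₁) = uniform-crossing {_} {k} {λ₁} {λ₂} T m<k crossing dimS₁

      by-cases : Crossing T ⊎ T ⊑ H → ∃[ n ] UniformCard t k λ₁ λ₂ T n
      by-cases (inj₂ T⊆H)      = uniform-inside {t} {k} {λ₁} {λ₂} T T⊆H dimT
      by-cases (inj₁ crossing) = crossing-case t≤k crossing (crossing-dimension T crossing dimT)

  -- Assembly of the new large set.

  largeSet-extension : ∀ {N t k v} → t ≤ k → LargeSet F (suc N) t k v → LargeSet F (suc N) t (suc k) v →
           LargeSet F (suc N) t (suc k) (suc v)
  largeSet-extension {N} {t} {k} {v} t≤k L₁ L₂ = record
    { V        = V
    -- The `λᵛ` spaces of dimension `suc k` through a `t`-space are shared equally by the `suc N`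
    -- parts.
    ; λ′       = λᵛ / suc N
    ; 𝓑        = 𝓑
    ; design   = λ i → record
      { ambient-dimension = dimV
      ; respects          = λ {K} {L} → Union.𝓑-respects (L₁.design i) (L₂.design i) {K} {L}
      ; block-dimension   = λ {K} → Union.𝓑-dimension (L₁.design i) (L₂.design i) K
      ; balanced          = balanced i
      }
    ; disjoint = λ i≢j {K} → disjoint i≢j {K}
    ; union    = (λ { {K} (i , K∈) → Union.𝓑-dimension (L₁.design i) (L₂.design i) K K∈ }) , λ {K} → covered K
    }
    where
    module L₁ = LargeSet L₁
    module L₂ = LargeSet L₂

    -- Every design records the dimension of its ambient space, and there is a part `zero` because
    -- the number of parts is a successor.
    dim₁ : HasDimension F L₁.V v U
    dim₁ = IsSubspaceDesign.ambient-dimension (L₁.design zero)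

    dim₂ : HasDimension F L₂.V v U
    dim₂ = IsSubspaceDesign.ambient-dimension (L₂.design zero)

    V : VectorSpace F
    V = F×_ L₁.V

    dimV : HasDimension F V (suc v) U
    dimV = F×-dimension L₁.V dim₁

    -- The two large sets live on unrelated spaces of dimension `v`; `φ` maps the second onto the
    -- first, so both land on the same hyperplane.
    φ : Embedding L₂.V L₁.V
    φ = equidimensional L₂.V L₁.V dim₂ dim₁

    ι₁ : Embedding L₁.V V
    ι₁ = ι L₁.V

    ι₂ : Embedding L₂.V V
    ι₂ = ι₁ ∘ᴱ φ

    open Module V using (≈ᴹ-trans)

    same-range : _≈ˢ_ F V (Embedding.range ι₁) (Embedding.range ι₂)
    same-range =
      (λ { (x , _ , eq) → let (y , φy≈x) = equidimensional-surjective L₂.V L₁.V dim₂ dim₁ x in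
        y , tt , ≈ᴹ-trans (Embedding.to-cong ι₁ φy≈x) eq }) ,
      λ { (y , _ , eq) → Embedding.to φ y , tt , eq }

    open HyperplaneSection V L₁.V L₂.V dimV dim₁ dim₂ ι₁ ι₂ same-range

    𝓑 : Fin (suc N) → Pred (Subspace F V) 0ℓ
    𝓑 i = Union.𝓑 (L₁.design i) (L₂.design i)

    disjoint : ∀ {i j} → i ≢ j → 𝓑 i ⊥ 𝓑 j
    disjoint i≢j {K} (inj₁ (_ , K∈) , inj₁ (_ , K∈′)) = L₂.disjoint i≢j {Embedding.preimage ι₂ K} (K∈ , K∈′)
    disjoint i≢j {K} (inj₂ (_ , K∈) , inj₂ (_ , K∈′)) = L₁.disjoint i≢j {Embedding.preimage ι₁ K} (K∈ , K∈′)
    disjoint i≢j (inj₁ (K⊆H , _) , inj₂ ((x , x∈K , x∉H) , _)) = x∉H (K⊆H x∈K)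
    disjoint i≢j (inj₂ ((x , x∈K , x∉H) , _) , inj₁ (K⊆H , _)) = x∉H (K⊆H x∈K)

    covered : ∀ K → OfDimension F V (suc k) K → ∃[ i ] K ∈ 𝓑 i
    covered K dimK = by-cases (crossing-or-inside K dimK)
      where
      crossing-case : Crossing K → ∃[ m ] suc k ≡ suc m × OfDimension F L₁.V m (Embedding.preimage ι₁ K) →
                      ∃[ i ] K ∈ 𝓑 i
      crossing-case crossing (_ , ≡.refl , dimL) = map₂ (λ L∈ → inj₂ (crossing , L∈)) (proj₂ L₁.union dimL)

      by-cases : Crossing K ⊎ _⊆ˢ_ F V K H → ∃[ i ] K ∈ 𝓑 i
      by-cases (inj₂ K⊆H) = map₂ (λ K∈ → inj₁ ((λ {x} → K⊆H {x}) , K∈)) (proj₂ L₂.union (inside-dimension K K⊆H dimK))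
      by-cases (inj₁ crossing) = crossing-case crossing (crossing-dimension K crossing dimK)

    all-design : ∃[ λ′ ] IsSubspaceDesign F V t (suc v) (suc k) λ′ (OfDimension F V (suc k))
    all-design = FiniteSpace.allBlocks-design V dimV (suc k ∸ t) t (m∸n+n≡m (m≤n⇒m≤1+n t≤k))

    λᵛ : ℕ
    λᵛ = proj₁ all-design

    -- The index is the one chosen by `covered`; by disjointness it does not depend on the
    -- representative of the subspace.
    part : ∀ T → Setoid.Carrier (blocksContaining F V (OfDimension F V (suc k)) T) → Fin (suc N)
    part T (K , dimK , _) = proj₁ (covered K dimK)

    part-unique : ∀ {i j} K → K ∈ 𝓑 i → K ∈ 𝓑 j → i ≡ j
    part-unique {i} {j} K K∈ K∈′ = decidable-stable (i ≟ j) λ i≢j → disjoint i≢j {K} (K∈ , K∈′)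

    -- The `suc k`-spaces through `T` are fibred over the parts, and the fibre over `i` consists of
    -- the blocks of part `i` through `T`.
    allBlocks-card : ∀ {n} T → (∀ i → HasCardinality (blocksContaining F V (𝓑 i) T) n) →
                     HasCardinality (blocksContaining F V (OfDimension F V (suc k)) T) (suc N * n)
    allBlocks-card T card = card-fibred {A = blocks} {B = setoid (Fin (suc N))} (part T)
      (λ { {K , dimK , _} {L , dimL , _} K≋L → part-unique L
        (Union.𝓑-respects (L₁.design _) (L₂.design _) {K} {L} K≋L (proj₂ (covered K dimK)))
        (proj₂ (covered L dimL)) })
      (enumeration⇒card id id (λ i → i , ≡.refl))
      λ i → card-transfer {A = blocksContaining F V (𝓑 i) T} {B = fibre blocks (setoid (Fin (suc N))) (part T) i}
        (inPart i) id id
        (λ { ((K , dimK , T⊆K) , ≡.refl) → (K , proj₂ (covered K dimK) , T⊆K) , id , id })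
        (card i)
      where
      blocks : Setoid _ _
      blocks = blocksContaining F V (OfDimension F V (suc k)) T

      inPart : ∀ i → Setoid.Carrier (blocksContaining F V (𝓑 i) T) →
               Setoid.Carrier (fibre blocks (setoid (Fin (suc N))) (part T) i)
      inPart i (K , K∈ , T⊆K) = (K , dimK , T⊆K) , part-unique K (proj₂ (covered K dimK)) K∈
        where
        dimK : OfDimension F V (suc k) K
        dimK = Union.𝓑-dimension (L₁.design i) (L₂.design i) K K∈

    -- The number `n` from `uniform-card` might still vary with `T`. Summing over all parts gives
    -- `suc N * n ≡ λᵛ`, which pins it down.
    balanced : ∀ i T → OfDimension F V t T → HasCardinality (blocksContaining F V (𝓑 i) T) (λᵛ / suc N)
    balanced i T dimT = rescale (uniform-card T t≤k dimT)
      where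
      rescale : ∃[ n ] UniformCard t k L₁.λ′ L₂.λ′ T n →
                HasCardinality (blocksContaining F V (𝓑 i) T) (λᵛ / suc N)
      rescale (n , cards) = ≡.subst (HasCardinality (blocksContaining F V (𝓑 i) T)) n≡λ/N (card i)
        where
        card : ∀ i → HasCardinality (blocksContaining F V (𝓑 i) T) n
        card i = cards (L₁.𝓑 i) (L₂.𝓑 i) (L₁.design i) (L₂.design i)

        n≡λ/N : n ≡ λᵛ / suc N
        n≡λ/N = ≡.trans (≡.sym (m*n/n≡m n (suc N))) (≡.cong (_/ suc N) (≡.trans (*-comm n (suc N))
          (card-unique (allBlocks-card T card) (IsSubspaceDesign.balanced (proj₂ all-design) T dimT))))

corollary20 : ∀ (q : ℕ) → IsPrimePower q → (F : FiniteField q) →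
    ∀ (N t k v : ℕ) → 1 ≤ N → t < k → t < v →
    LargeSet F N t (k ∸ 1) (v ∸ 1) →
    LargeSet F N t k (v ∸ 1) →
    LargeSet F N t k v
-- With `N`, `k` and `v` written as successors, `∸ 1` computes. The bound `1 < q` is
-- `p ^ 0 < p ^ n`, from 1 < p and 0 < n.
corollary20 q (p , n , p-prime , 1≤n , ≡.refl) F (suc N) t (suc k) (suc v) _ t<k _ =
  largeSet-extension F (^-monoʳ-< p (nonTrivial⇒n>1 p {{prime⇒nonTrivial p-prime}}) 1≤n) (s≤s⁻¹ t<k)
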